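{- Let $n \geq r$ and let $\mathcal{E}(r)=\{g_0=\emptyset,g_1,\ldots,g_m\}$. For every graph $h\in\mathcal{E}(n)$ the vector $z=(z_0,z_1,\ldots,z_m)^T$ with $z_i=I(g_i)(h)$ (so $z_0=1$) satisfies $$z\in\mathbb{Z}^{m+1},\quad z\geq 0,$$ $$(E^T)^{ -1}Dz\geq 0,$$ $$z_iz_j-\sum_{k=0}^m c_{ij}^k z_k=0\quad\text{for all } i,j \text{ such that } cv(g_i)+cv(g_j)\leq r,$$ where inequalities are componentwise, $E$ is the $E$-transform of $\mathcal{E}(r)$, $$D=\mathrm{diag}\left(\binom{n}{r},\binom{n-cv(g_1)}{r-cv(g_1)},\ldots,\binom{n-cv(g_m)}{r-cv(g_m)}\right),$$ and $c_{ij}^k=\sum_{l=0}^m(-1)^{|g_k|-|g_l|}e_{kl}e_{li}e_{lj}$.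
   Context: All graphs are finite and simple. $\mathcal{E}(n)$ is the set of isomorphism classes of simple graphs with $n$ vertices. For graphs $g,h$, $I(g)(h)$ is the number of (not necessarily induced) subgraphs of $h$ isomorphic to $g$, isolated vertices being disregarded: it is the number of edge subsets of $h$ which, as graphs without isolated vertices, are isomorphic to $g$ with its isolated vertices removed. $I(\emptyset)=1$ for the graph $\emptyset$ without edges. $|g|$ is the number of edges of $g$ and $cv(g)$ is the number of vertices of $g$ having at least one edge connected to them. The $E$-transform of $\mathcal{E}(r)=\{g_0,\ldots,g_m\}$ is the (invertible) matrix $E=(e_{ij})_{0\le i,j\le m}$ with $e_{ij}=I(g_j)(g_i)$. -}

module Defs where

open import Algebra.Properties.Semiring.Sum using (sum)
open import Data.Bool.Base using (Bool; true; false; _∧_; _∨_; if_then_else_)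
import Data.Bool.Properties as Bool
open import Data.Fin.Base using (Fin; zero; _<_; finToFun; funToFin)
open import Data.Fin.Permutation
  using (Permutation; permutation; _⟨$⟩ʳ_; _⟨$⟩ˡ_; inverseˡ; inverseʳ)
open import Data.Fin.Properties
  using (_≟_; _<?_; any?; all?; finToFun-funToFin)
open import Data.Integer.Base using (ℤ; +_; 0ℤ; 1ℤ; -1ℤ; _*_; _-_; _^_; ∣_∣)
open import Data.Integer.Properties using (+-*-semiring)
open import Data.List.Base
  using (List; []; _∷_; _++_; map; filter; length; lookup; allFin; cartesianProduct)
import Data.List.Membership.DecPropositional as DecMembership
open import Data.Nat.Base using (ℕ; suc; _∸_) renaming (_^_ to _^ℕ_)
open import Data.Nat.Combinatorics using (_C_)
open import Data.Product.Base using (_×_; _,_; ∃; uncurry)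
open import Data.Product.Properties using (≡-dec)
open import Relation.Binary.Core using (Rel)
open import Relation.Binary.PropositionalEquality
  using (_≡_; sym; trans; cong; cong₂)
open import Relation.Nullary.Decidable
  using (Dec; does; map′; _×-dec_)
open import Level using (0ℓ)

private
  variable
    a b k n r : ℕ

record Graph (n : ℕ) : Set where
  field
    adj        : Fin n → Fin n → Bool
    adj-sym    : ∀ u v → adj u v ≡ adj v u
    adj-irrefl : ∀ v → adj v v ≡ false

open Graph public

Edgeless : Graph n → Set
Edgeless g = ∀ u v → adj g u v ≡ false

infix 4 _≅_ _≅?_

record _≅_ (g : Graph a) (h : Graph b) : Set where
  field
    bijection     : Permutation a b
    preserves-adj : ∀ u v → adj g u v ≡ adj h (bijection ⟨$⟩ʳ u) (bijection ⟨$⟩ʳ v)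

-- Exhaustive search over the pairs of mutually inverse functions.
_≅?_ : (g : Graph a) (h : Graph b) → Dec (g ≅ h)
_≅?_ {a} {b} g h = map′ to from
  (any? λ i → any? λ j → all? (λ u → bwd j (fwd i u) ≟ u)
                   ×-dec all? (λ v → fwd i (bwd j v) ≟ v)
                   ×-dec all? λ u → all? λ v →
                           adj g u v Bool.≟ adj h (fwd i u) (fwd i v))
  where
  fwd : Fin (b ^ℕ a) → Fin a → Fin b
  fwd = finToFun

  bwd : Fin (a ^ℕ b) → Fin b → Fin a
  bwd = finToFun

  Found : Fin (b ^ℕ a) → Fin (a ^ℕ b) → Set
  Found i j = (∀ u → bwd j (fwd i u) ≡ u)
            × (∀ v → fwd i (bwd j v) ≡ v)
            × (∀ u v → adj g u v ≡ adj h (fwd i u) (fwd i v))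

  to : (∃ λ i → ∃ λ j → Found i j) → g ≅ h
  to (i , j , ji , ij , p) = record
    { bijection     = permutation (fwd i) (bwd j) ij ji
    ; preserves-adj = p
    }

  from : g ≅ h → ∃ λ i → ∃ λ j → Found i j
  from iso = funToFin (π ⟨$⟩ʳ_) , funToFin (π ⟨$⟩ˡ_)
    , (λ u → trans (back (fwd _ u)) (trans (cong (π ⟨$⟩ˡ_) (forth u)) (inverseˡ π)))
    , (λ v → trans (forth (bwd _ v)) (trans (cong (π ⟨$⟩ʳ_) (back v)) (inverseʳ π)))
    , (λ u v → trans (preserves-adj u v) (sym (cong₂ (adj h) (forth u) (forth v))))
    where
    open _≅_ iso renaming (bijection to π)
    forth : ∀ u → fwd (funToFin (π ⟨$⟩ʳ_)) u ≡ π ⟨$⟩ʳ u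
    forth = finToFun-funToFin (π ⟨$⟩ʳ_)
    back : ∀ v → bwd (funToFin (π ⟨$⟩ˡ_)) v ≡ π ⟨$⟩ˡ v
    back = finToFun-funToFin (π ⟨$⟩ˡ_)

nonIsolated : Graph n → List (Fin n)
nonIsolated {n} g = filter (λ v → any? λ w → adj g v w Bool.≟ true) (allFin n)

cv : Graph n → ℕ
cv g = length (nonIsolated g)

removeIsolated : (g : Graph n) → Graph (cv g)
removeIsolated g = record
  { adj        = λ i j → adj g (vertex i) (vertex j)
  ; adj-sym    = λ i j → adj-sym g (vertex i) (vertex j)
  ; adj-irrefl = λ i → adj-irrefl g (vertex i)
  }
  where vertex = lookup (nonIsolated g)

Edge : ℕ → Set
Edge n = Fin n × Fin n

-- Each edge {u , v} is listed once, as the pair with u < v.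
edges : Graph n → List (Edge n)
edges {n} g =
  filter (uncurry λ u v → u <? v ×-dec adj g u v Bool.≟ true)
         (cartesianProduct (allFin n) (allFin n))

size : Graph n → ℕ
size g = length (edges g)

sublists : {A : Set} → List A → List (List A)
sublists []       = [] ∷ []
sublists (x ∷ xs) = map (x ∷_) (sublists xs) ++ sublists xs

-- The graph on all of the vertices of h, with only the edges of h in es.
_↾_ : Graph n → List (Edge n) → Graph n
_↾_ {n} h es = record
  { adj        = λ u v → adj h u v ∧ (does ((u , v) ∈? es) ∨ does ((v , u) ∈? es))
  ; adj-sym    = λ u v → cong₂ _∧_ (adj-sym h u v)
                           (Bool.∨-comm (does ((u , v) ∈? es)) (does ((v , u) ∈? es)))
  ; adj-irrefl = λ v → cong (_∧ _) (adj-irrefl h v)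
  }
  where open DecMembership (≡-dec (_≟_ {n}) (_≟_ {n})) using (_∈?_)

-- `edges h` has no repetitions, so its sublists are the edge subsets of h,
-- each occurring exactly once.
I : Graph a → Graph b → ℕ
I g h = length (filter (λ es → removeIsolated (h ↾ es) ≅? removeIsolated g)
                       (sublists (edges h)))

-- A list g₀, …, gₘ of representatives of the isomorphism classes of graphs
-- with r vertices, each class represented exactly once and g₀ = ∅.
record IsoClasses (r m : ℕ) : Set where
  field
    rep      : Fin (suc m) → Graph r
    rep-zero : Edgeless (rep zero)
    complete : ∀ (g : Graph r) → ∃ λ i → g ≅ rep i
    distinct : ∀ i j → rep i ≅ rep j → i ≡ j

Σℤ : (Fin k → ℤ) → ℤ
Σℤ = sum +-*-semiring

Vector : ℕ → Set
Vector k = Fin k → ℤ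

Matrix : ℕ → Set
Matrix k = Fin k → Fin k → ℤ

infix  4 _≈ᴹ_
infixl 7 _·_
infixr 7 _·ᵛ_
infix  8 _ᵀ

_≈ᴹ_ : Rel (Matrix k) 0ℓ
A ≈ᴹ B = ∀ i j → A i j ≡ B i j

diag : Vector k → Matrix k
diag d i j = if does (i ≟ j) then d i else 0ℤ

1ᴹ : Matrix k
1ᴹ = diag λ _ → 1ℤ

_ᵀ : Matrix k → Matrix k
(A ᵀ) i j = A j i

_·_ : Matrix k → Matrix k → Matrix k
(A · B) i j = Σℤ λ l → A i l * B l j

_·ᵛ_ : Matrix k → Vector k → Vector k
(A ·ᵛ x) i = Σℤ λ j → A i j * x j

E-transform : (Fin k → Graph r) → Matrix k
E-transform g i j = + I (g j) (g i)

-- cv (g i) ≤ r, so the truncated subtractions are exact when r ≤ n.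
D-matrix : ℕ → (Fin k → Graph r) → Matrix k
D-matrix {r = r} n g = diag λ i → + ((n ∸ cv (g i)) C (r ∸ cv (g i)))

-- (-1)^d for an integer exponent d, which may be negative.
sign : ℤ → ℤ
sign d = -1ℤ ^ ∣ d ∣

structureConst : (Fin k → Graph r) → Fin k → Fin k → Fin k → ℤ
structureConst g i j k =
  Σℤ λ l → sign (+ size (g k) - + size (g l)) * e k l * e l i * e l j
  where e = E-transform g

{-# OPTIONS --safe #-}
module Submission where

-- Write g ≈ h when g and h are isomorphic up to isolated vertices.  Every graph x
-- with cv x ≤ r satisfies x ≈ gₗ for exactly one l, so for an ≈-invariant Φ
--   Σₗ I(gₗ)(x) Φ(gₗ) = Σ_{S ⊆ E(x)} Φ(x restricted to S).
-- With Φ(y) = (-1)^|y| I(gᵢ)(y), Möbius inversion over edge subsets turns the right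
-- side into (-1)^|x| [x ≈ gᵢ].  For x = gₖ this says that E has the inverse with
-- entries (-1)^(|gₖ|+|gₗ|) eₖₗ.  Counting the pairs of a copy of gₗ in h and an r-set V of
-- vertices containing it gives (Dz)ₗ = Σ_V I(gₗ)(h[V]), and inverting each summand shows
-- that ((Eᵀ)⁻¹Dz)ᵢ is the number of r-sets V with h[V] ≈ gᵢ.
-- Finally zᵢzⱼ counts pairs of copies, and sorting these by their union U gives the
-- product formula: by inclusion–exclusion the number of pairs with union U is cᵢⱼᵏ
-- if U ≈ gₖ, and it vanishes if cv(U) > r ≥ cv(gᵢ) + cv(gⱼ).

open import Defs
open import Algebra.Definitions using (Invertible)
open import Algebra.Properties.Semiring.Sum
  using (sum-cong-≗; ∑-distrib-+; *-distribˡ-sum; sum-remove; sum-replicate-zero)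
open import Data.Bool.Base using (Bool; true; false; _∧_; _∨_; if_then_else_)
import Data.Bool.Properties as Bool
open import Data.Empty using (⊥-elim)
open import Data.Fin.Base using (Fin; _<_; zero; suc; punchIn; inject≤)
open import Data.Fin.Permutation as Perm
  using (Permutation; permutation; _⟨$⟩ʳ_; _⟨$⟩ˡ_; inverseˡ; inverseʳ)
import Data.Fin.Properties as Fin
open import Data.Fin.Properties
  using (_≟_; _<?_; any?; punchInᵢ≢i; <-cmp; <-asym; injective⇒≤; inject≤-injective
        ; inject≤-idempotent)
open import Data.Integer.Base using (ℤ; +_; -_; 0ℤ; 1ℤ; -1ℤ; _+_; _*_; _-_; _≤_; +≤+; _^_; _⊖_)
import Data.Integer.Properties as ℤ
open import Data.Integer.Tactic.RingSolver using (solve-∀)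
open import Data.List.Base
  using (List; []; _∷_; _++_; map; filter; length; lookup; allFin; cartesianProduct)
import Data.List.Properties as List
open import Data.List.Membership.Propositional using (_∈_)
open import Data.List.Membership.Propositional.Properties
  using (∈-filter⁺; ∈-filter⁻; ∈-map⁺; ∈-map⁻; ∈-cartesianProduct⁺; ∈-allFin; ∈-lookup; ∈-++⁺ˡ
        ; ∈-++⁺ʳ)
open import Data.List.Membership.Propositional.Properties.WithK using (unique∧set⇒bag)
import Data.List.Membership.DecPropositional as DecMembership
open import Data.List.Relation.Binary.BagAndSetEquality using (∼bag⇒↭)
open import Data.List.Relation.Binary.Permutation.Propositional
  using (_↭_; refl; prep; swap; ↭-sym) renaming (trans to trans↭)
open import Data.List.Relation.Binary.Permutation.Propositional.Properties
  using (∈-resp-↭; ↭-length)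
open import Data.List.Relation.Binary.Sublist.Propositional using (_⊆_; []; _∷_; _∷ʳ_; ⊆-trans)
import Data.List.Relation.Binary.Sublist.Propositional as Sublist
open import Data.List.Relation.Binary.Sublist.Propositional.Properties using (filter-⊆)
open import Data.List.Relation.Unary.All as All using (All; []; _∷_)
open import Data.List.Relation.Unary.AllPairs using ([]; _∷_)
open import Data.List.Relation.Unary.Any using (here; there; index)
open import Data.List.Relation.Unary.Any.Properties using (lookup-index)
open import Data.List.Relation.Unary.Unique.Propositional using (Unique)
import Data.List.Relation.Unary.Unique.Propositional.Properties as Unique
open import Data.Nat.Base
  using (ℕ; zero; suc; _∸_; z≤n) renaming (_+_ to _+ℕ_; _≤_ to _≤ℕ_; _<_ to _<ℕ_)
import Data.Nat.Properties as ℕ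
open import Data.Nat.Combinatorics using (_C_; nCk+nC[k+1]≡[n+1]C[k+1])
open import Data.Product.Base using (Σ; ∃; _×_; _,_; proj₁; proj₂; uncurry)
open import Data.Product.Properties using (≡-dec)
open import Data.Sum.Base as Sum using (_⊎_; inj₁; inj₂; [_,_]′)
open import Function.Base using (_∘_)
open import Function.Bundles using (mk⇔)
open import Relation.Binary.Definitions using (tri<; tri≈; tri>)
open import Relation.Binary.PropositionalEquality
  using (_≡_; _≢_; refl; sym; trans; cong; cong₂; subst; module ≡-Reasoning)
open import Relation.Nullary using (¬_; Dec; yes; no; does; contradiction)
open import Relation.Nullary.Decidable using (_×-dec_; _→-dec_; dec-true; dec-false)
open import Relation.Unary using (Decidable)

open ≡-Reasoning

private
  variable
    a b k n r : ℕ
    A B X P Q : Set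

-- Indicators of decidable propositions, and signs

𝟙 : Dec P → ℤ
𝟙 p? = if does p? then 1ℤ else 0ℤ

𝟙-yes : (p? : Dec P) → P → 𝟙 p? ≡ 1ℤ
𝟙-yes p? p = cong (λ d → if d then 1ℤ else 0ℤ) (dec-true p? p)

𝟙-no : (p? : Dec P) → ¬ P → 𝟙 p? ≡ 0ℤ
𝟙-no p? ¬p = cong (λ d → if d then 1ℤ else 0ℤ) (dec-false p? ¬p)

𝟙-cong : (p? : Dec P) (q? : Dec Q) → (P → Q) → (Q → P) → 𝟙 p? ≡ 𝟙 q?
𝟙-cong p? (yes q) p⇒q q⇒p = 𝟙-yes p? (q⇒p q)
𝟙-cong p? (no ¬q) p⇒q q⇒p = 𝟙-no p? (¬q ∘ p⇒q)

𝟙-× : (p? : Dec P) (q? : Dec Q) → 𝟙 (p? ×-dec q?) ≡ 𝟙 p? * 𝟙 q?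
𝟙-× (yes _) (yes _) = refl
𝟙-× (yes _) (no _)  = refl
𝟙-× (no _)  q?      = sym (ℤ.*-zeroˡ (𝟙 q?))

𝟙*-cong : (p? : Dec P) {x y : ℤ} → (P → x ≡ y) → 𝟙 p? * x ≡ 𝟙 p? * y
𝟙*-cong (yes p)         eq = cong (1ℤ *_) (eq p)
𝟙*-cong (no _) {x} {y} eq = trans (ℤ.*-zeroˡ x) (sym (ℤ.*-zeroˡ y))

0≤𝟙 : (p? : Dec P) → 0ℤ ≤ 𝟙 p?
0≤𝟙 (yes _) = +≤+ z≤n
0≤𝟙 (no _)  = +≤+ z≤n

-- The sign (-1)^n, by recursion on `n`, so that adding one edge negates it by definition.
ε : ℕ → ℤ
ε zero    = 1ℤ
ε (suc n) = - ε n

ε² : ∀ n → ε n * ε n ≡ 1ℤ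
ε² zero    = refl
ε² (suc n) = trans (lemma (ε n)) (ε² n)
  where
  lemma : ∀ x → - x * - x ≡ x * x
  lemma = solve-∀

-1^ : ∀ n → -1ℤ ^ n ≡ ε n
-1^ zero    = refl
-1^ (suc n) = trans (ℤ.-1*i≡-i _) (cong -_ (-1^ n))

-- The parity of m - n is that of m + n: lowering both arguments by one keeps the difference and
-- flips both signs on the right.
sign-⊖ : ∀ m n → sign (m ⊖ n) ≡ ε m * ε n
sign-⊖ zero    zero    = refl
sign-⊖ zero    (suc n) = trans (-1^ (suc n)) (sym (ℤ.*-identityˡ _))
sign-⊖ (suc m) zero    = trans (-1^ (suc m)) (sym (ℤ.*-identityʳ _))
sign-⊖ (suc m) (suc n) = trans (cong sign (ℤ.[1+m]⊖[1+n]≡m⊖n m n)) (trans (sign-⊖ m n) (lemma (ε m) (ε n)))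
  where
  lemma : ∀ x y → x * y ≡ - x * - y
  lemma = solve-∀

sign-minus : ∀ m n → sign (+ m - + n) ≡ ε m * ε n
sign-minus m n = trans (cong sign (ℤ.[+m]-[+n]≡m⊖n m n)) (sign-⊖ m n)

-- Sums over the sublists of a list

-- The recursion follows that of `sublists`: the head is chosen or left out, and the choice is
-- absorbed into `f`. Inductions on the list then split each sum by that choice.
Σ⊆ : (List A → ℤ) → List A → ℤ
Σ⊆ f []       = f []
Σ⊆ f (x ∷ xs) = Σ⊆ (f ∘ (x ∷_)) xs + Σ⊆ f xs

Σ⊆-cong : {f g : List A → ℤ} (xs : List A) → (∀ {ys} → ys ⊆ xs → f ys ≡ g ys) → Σ⊆ f xs ≡ Σ⊆ g xs
Σ⊆-cong []       eq = eq []
Σ⊆-cong (x ∷ xs) eq = cong₂ _+_ (Σ⊆-cong xs (eq ∘ (refl ∷_))) (Σ⊆-cong xs (eq ∘ (x ∷ʳ_)))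

-- Any additive functional passes through the case split on the head. The instances are exchanges
-- with another sum over sublists and with a sum over `Fin k`.
Σ⊆-linear : (L : (X → ℤ) → ℤ) → (∀ f g → L (λ x → f x + g x) ≡ L f + L g) →
            (f : List A → X → ℤ) (xs : List A) →
            Σ⊆ (λ ys → L (f ys)) xs ≡ L (λ x → Σ⊆ (λ ys → f ys x) xs)
Σ⊆-linear L L-+ f []       = refl
Σ⊆-linear L L-+ f (x ∷ xs) =
  trans (cong₂ _+_ (Σ⊆-linear L L-+ (f ∘ (x ∷_)) xs) (Σ⊆-linear L L-+ f xs)) (sym (L-+ _ _))

+-interchange : ∀ p q s t → p + q + (s + t) ≡ p + s + (q + t)
+-interchange = solve-∀

Σ⊆-+ : (f g : List A → ℤ) (xs : List A) → Σ⊆ (λ ys → f ys + g ys) xs ≡ Σ⊆ f xs + Σ⊆ g xs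
Σ⊆-+ f g []       = refl
Σ⊆-+ f g (x ∷ xs) =
  trans (cong₂ _+_ (Σ⊆-+ (f ∘ (x ∷_)) (g ∘ (x ∷_)) xs) (Σ⊆-+ f g xs))
        (+-interchange (Σ⊆ (f ∘ (x ∷_)) xs) (Σ⊆ (g ∘ (x ∷_)) xs) (Σ⊆ f xs) (Σ⊆ g xs))

Σ⊆-* : (c : ℤ) (f : List A → ℤ) (xs : List A) → Σ⊆ (λ ys → c * f ys) xs ≡ c * Σ⊆ f xs
Σ⊆-* c f []       = refl
Σ⊆-* c f (x ∷ xs) = trans (cong₂ _+_ (Σ⊆-* c (f ∘ (x ∷_)) xs) (Σ⊆-* c f xs)) (sym (ℤ.*-distribˡ-+ c _ _))

Σ⊆-zero : {f : List A → ℤ} (xs : List A) → (∀ {ys} → ys ⊆ xs → f ys ≡ 0ℤ) → Σ⊆ f xs ≡ 0ℤ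
Σ⊆-zero []       eq = eq []
Σ⊆-zero (x ∷ xs) eq = cong₂ _+_ (Σ⊆-zero xs (eq ∘ (refl ∷_))) (Σ⊆-zero xs (eq ∘ (x ∷ʳ_)))

0≤Σ⊆ : {f : List A → ℤ} (xs : List A) → (∀ ys → 0ℤ ≤ f ys) → 0ℤ ≤ Σ⊆ f xs
0≤Σ⊆ []       0≤f = 0≤f []
0≤Σ⊆ (x ∷ xs) 0≤f = ℤ.+-mono-≤ (0≤Σ⊆ xs (0≤f ∘ (x ∷_))) (0≤Σ⊆ xs 0≤f)

Σ⊆-swap : (f : List A → List B → ℤ) (xs : List A) (ys : List B) →
          Σ⊆ (λ S → Σ⊆ (f S) ys) xs ≡ Σ⊆ (λ T → Σ⊆ (λ S → f S T) xs) ys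
Σ⊆-swap f xs ys = Σ⊆-linear (λ g → Σ⊆ g ys) (λ g h → Σ⊆-+ g h ys) f xs

Σ⊆-Σℤ : (f : List A → Fin k → ℤ) (xs : List A) →
        Σ⊆ (λ S → Σℤ (f S)) xs ≡ Σℤ (λ i → Σ⊆ (λ S → f S i) xs)
Σ⊆-Σℤ f xs = Σ⊆-linear Σℤ (∑-distrib-+ ℤ.+-*-semiring) f xs

Σ⊆-map : (f : List B → ℤ) (φ : A → B) (xs : List A) → Σ⊆ f (map φ xs) ≡ Σ⊆ (f ∘ map φ) xs
Σ⊆-map f φ []       = refl
Σ⊆-map f φ (x ∷ xs) = cong₂ _+_ (Σ⊆-map (f ∘ (φ x ∷_)) φ xs) (Σ⊆-map f φ xs)

-- Permuting a list permutes the members of each sublist, hence the condition on `f`. A swap of the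
-- first two elements exchanges the two sums in which exactly one of them is chosen.
Σ⊆-↭ : {f : List A → ℤ} → (∀ {S T} → S ↭ T → f S ≡ f T) → {xs ys : List A} → xs ↭ ys → Σ⊆ f xs ≡ Σ⊆ f ys
Σ⊆-↭ f-↭ refl = refl
Σ⊆-↭ f-↭ (prep x p) = cong₂ _+_ (Σ⊆-↭ (f-↭ ∘ prep x) p) (Σ⊆-↭ f-↭ p)
Σ⊆-↭ {f = f} f-↭ {x ∷ y ∷ xs} {y ∷ x ∷ ys} (swap x y p) = begin
  Σ⊆ (f ∘ (x ∷_) ∘ (y ∷_)) xs + Σ⊆ (f ∘ (x ∷_)) xs + (Σ⊆ (f ∘ (y ∷_)) xs + Σ⊆ f xs)
    ≡⟨ cong₂ _+_ (cong₂ _+_ (trans (Σ⊆-cong xs λ _ → f-↭ (swap x y refl))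
                                   (Σ⊆-↭ (f-↭ ∘ prep y ∘ prep x) p))
                            (Σ⊆-↭ (f-↭ ∘ prep x) p))
                 (cong₂ _+_ (Σ⊆-↭ (f-↭ ∘ prep y) p) (Σ⊆-↭ f-↭ p)) ⟩
  Σ⊆ (f ∘ (y ∷_) ∘ (x ∷_)) ys + Σ⊆ (f ∘ (x ∷_)) ys + (Σ⊆ (f ∘ (y ∷_)) ys + Σ⊆ f ys)
    ≡⟨ +-interchange (Σ⊆ (f ∘ (y ∷_) ∘ (x ∷_)) ys) (Σ⊆ (f ∘ (x ∷_)) ys) (Σ⊆ (f ∘ (y ∷_)) ys) (Σ⊆ f ys) ⟩
  Σ⊆ (f ∘ (y ∷_) ∘ (x ∷_)) ys + Σ⊆ (f ∘ (y ∷_)) ys + (Σ⊆ (f ∘ (x ∷_)) ys + Σ⊆ f ys) ∎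
Σ⊆-↭ f-↭ (trans↭ p q) = trans (Σ⊆-↭ f-↭ p) (Σ⊆-↭ f-↭ q)

Σ⊆-filter : {P : A → Set} (P? : Decidable P) (f : List A → ℤ) (xs : List A) →
            Σ⊆ f (filter P? xs) ≡ Σ⊆ (λ S → 𝟙 (All.all? P? S) * f S) xs
Σ⊆-filter P? f [] = sym (ℤ.*-identityˡ _)
Σ⊆-filter P? f (x ∷ xs) with P? x
... | yes _ = cong₂ _+_ (Σ⊆-filter P? (f ∘ (x ∷_)) xs) (Σ⊆-filter P? f xs)
... | no _  = begin
  Σ⊆ f (filter P? xs)                           ≡⟨ Σ⊆-filter P? f xs ⟩
  Σ⊆ (λ S → 𝟙 (All.all? P? S) * f S) xs         ≡⟨ ℤ.+-identityˡ _ ⟨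
  0ℤ + Σ⊆ (λ S → 𝟙 (All.all? P? S) * f S) xs
    ≡⟨ cong (_+ Σ⊆ (λ S → 𝟙 (All.all? P? S) * f S) xs) (Σ⊆-zero xs λ {S} _ → ℤ.*-zeroˡ (f (x ∷ S))) ⟨
  Σ⊆ (λ S → 0ℤ * f (x ∷ S)) xs + Σ⊆ (λ S → 𝟙 (All.all? P? S) * f S) xs ∎

-- This turns the list count in the definition of `I` into a sum open to manipulation.
length-filter-sublists : {P : List A → Set} (P? : Decidable P) (xs : List A) →
                         + length (filter P? (sublists xs)) ≡ Σ⊆ (λ S → 𝟙 (P? S)) xs
length-filter-sublists P? [] with does (P? [])
... | true  = refl
... | false = refl
length-filter-sublists P? (x ∷ xs) = begin
  + length (filter P? (map (x ∷_) (sublists xs) ++ sublists xs))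
    ≡⟨ cong (λ l → + length l) (List.filter-++ P? (map (x ∷_) (sublists xs)) (sublists xs)) ⟩
  + length (filter P? (map (x ∷_) (sublists xs)) ++ filter P? (sublists xs))
    ≡⟨ cong +_ (List.length-++ (filter P? (map (x ∷_) (sublists xs)))) ⟩
  + length (filter P? (map (x ∷_) (sublists xs))) + + length (filter P? (sublists xs))
    ≡⟨ cong₂ _+_ (cong +_ (length-filter-map (sublists xs))) (length-filter-sublists P? xs) ⟩
  + length (filter (P? ∘ (x ∷_)) (sublists xs)) + Σ⊆ (λ S → 𝟙 (P? S)) xs
    ≡⟨ cong (_+ Σ⊆ (λ S → 𝟙 (P? S)) xs) (length-filter-sublists (P? ∘ (x ∷_)) xs) ⟩
  Σ⊆ (λ S → 𝟙 (P? (x ∷ S))) xs + Σ⊆ (λ S → 𝟙 (P? S)) xs ∎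
  where
  length-filter-map : ∀ yss → length (filter P? (map (x ∷_) yss)) ≡ length (filter (P? ∘ (x ∷_)) yss)
  length-filter-map [] = refl
  length-filter-map (ys ∷ yss) with does (P? (x ∷ ys))
  ... | true  = cong suc (length-filter-map yss)
  ... | false = length-filter-map yss

-- Split `T` by whether it contains the head `x`. The inner sums over sublists without `x` occur
-- with both signs and cancel; what is left is the claim for `f ∘ (x ∷_)` on the tail.
möbius : (f : List A → ℤ) (xs : List A) →
         ε (length xs) * Σ⊆ (λ T → ε (length T) * Σ⊆ f T) xs ≡ f xs
möbius f [] = trans (ℤ.*-identityˡ _) (ℤ.*-identityˡ _)
möbius f (x ∷ xs) = begin
  - e * (Σ⊆ (λ T → - ε (length T) * (Σ⊆ (f ∘ (x ∷_)) T + Σ⊆ f T)) xs + G)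
    ≡⟨ cong (λ z → - e * (z + G)) (trans
         (Σ⊆-cong xs λ {T} _ → lemma₁ (ε (length T)) (Σ⊆ (f ∘ (x ∷_)) T) (Σ⊆ f T))
         (trans (Σ⊆-+ (λ T → -1ℤ * p T) (λ T → -1ℤ * q T) xs)
                (cong₂ _+_ (Σ⊆-* -1ℤ p xs) (Σ⊆-* -1ℤ q xs)))) ⟩
  - e * (-1ℤ * F + -1ℤ * G + G)
    ≡⟨ lemma₂ e F G ⟩
  e * F
    ≡⟨ möbius (f ∘ (x ∷_)) xs ⟩
  f (x ∷ xs) ∎
  where
  p q : List _ → ℤ
  p T = ε (length T) * Σ⊆ (f ∘ (x ∷_)) T
  q T = ε (length T) * Σ⊆ f T
  e F G : ℤ
  e = ε (length xs)
  F = Σ⊆ p xs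
  G = Σ⊆ q xs
  lemma₁ : ∀ s p q → - s * (p + q) ≡ -1ℤ * (s * p) + -1ℤ * (s * q)
  lemma₁ = solve-∀
  lemma₂ : ∀ s p q → - s * (-1ℤ * p + -1ℤ * q + q) ≡ s * p
  lemma₂ = solve-∀

-- The inversion in the opposite order, with the same cancellation: the terms `G U` without `x`
-- arise from `x ∷ U` and from `U` with opposite signs.
möbius′ : (f : List A → ℤ) (xs : List A) →
          Σ⊆ (λ U → ε (length U) * Σ⊆ (λ W → ε (length W) * f W) U) xs ≡ f xs
möbius′ f [] = trans (ℤ.*-identityˡ _) (ℤ.*-identityˡ _)
möbius′ f (x ∷ xs) = begin
  Σ⊆ (λ U → - ε (length U) * (Σ⊆ (λ W → - ε (length W) * f (x ∷ W)) U + G U)) xs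
    + Σ⊆ (λ U → ε (length U) * G U) xs
    ≡⟨ Σ⊆-+ _ (λ U → ε (length U) * G U) xs ⟨
  Σ⊆ (λ U → - ε (length U) * (Σ⊆ (λ W → - ε (length W) * f (x ∷ W)) U + G U) + ε (length U) * G U) xs
    ≡⟨ Σ⊆-cong xs (λ {U} _ → trans
         (cong (λ z → - ε (length U) * (z + G U) + ε (length U) * G U)
           (trans (Σ⊆-cong U λ {W} _ → lemma₁ (ε (length W)) (f (x ∷ W))) (Σ⊆-* -1ℤ (λ W → ε (length W) * f (x ∷ W)) U)))
         (lemma₂ (ε (length U)) (F U) (G U))) ⟩
  Σ⊆ (λ U → ε (length U) * F U) xs
    ≡⟨ möbius′ (f ∘ (x ∷_)) xs ⟩
  f (x ∷ xs) ∎
  where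
  F G : List _ → ℤ
  F U = Σ⊆ (λ W → ε (length W) * f (x ∷ W)) U
  G U = Σ⊆ (λ W → ε (length W) * f W) U
  lemma₁ : ∀ s p → - s * p ≡ -1ℤ * (s * p)
  lemma₁ = solve-∀
  lemma₂ : ∀ s p q → - s * (-1ℤ * p + q) + s * q ≡ s * p
  lemma₂ = solve-∀

Σ⊆-*ʳ : (f : List A → ℤ) (c : ℤ) (xs : List A) → Σ⊆ (λ ys → f ys * c) xs ≡ Σ⊆ f xs * c
Σ⊆-*ʳ f c xs = trans (Σ⊆-cong xs λ {ys} _ → ℤ.*-comm (f ys) c) (trans (Σ⊆-* c f xs) (ℤ.*-comm c _))

Σ⊆-onlyEmpty : {f : List A → ℤ} (xs : List A) → (∀ {x ys} → x ∷ ys ⊆ xs → f (x ∷ ys) ≡ 0ℤ) → Σ⊆ f xs ≡ f []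
Σ⊆-onlyEmpty []       eq = refl
Σ⊆-onlyEmpty (x ∷ xs) eq =
  trans (cong₂ _+_ (Σ⊆-zero xs λ s → eq (refl ∷ s)) (Σ⊆-onlyEmpty xs (eq ∘ (x ∷ʳ_)))) (ℤ.+-identityˡ _)

Σℤ-cong : {f g : Fin k → ℤ} → (∀ i → f i ≡ g i) → Σℤ f ≡ Σℤ g
Σℤ-cong = sum-cong-≗ ℤ.+-*-semiring

Σℤ-zero : {f : Fin k → ℤ} → (∀ i → f i ≡ 0ℤ) → Σℤ f ≡ 0ℤ
Σℤ-zero {k} eq = trans (Σℤ-cong eq) (sum-replicate-zero ℤ.+-*-semiring k)

Σℤ-single : {f : Fin k → ℤ} (i : Fin k) → (∀ j → j ≢ i → f j ≡ 0ℤ) → Σℤ f ≡ f i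
Σℤ-single {suc k} {f} i eq = trans (sum-remove ℤ.+-*-semiring {i = i} f)
  (trans (cong (_+_ (f i)) (Σℤ-zero λ j → eq (punchIn i j) (punchInᵢ≢i i j))) (ℤ.+-identityʳ (f i)))

Σℤ-* : (c : ℤ) (f : Fin k → ℤ) → Σℤ (λ i → c * f i) ≡ c * Σℤ f
Σℤ-* c f = sym (*-distribˡ-sum ℤ.+-*-semiring c f)

-- Sublists `S` and `T` of `U` with union `U`, recorded position by position. The missing fourth
-- case, an element in neither, is the one that inclusion-exclusion cancels.
data Cover {A : Set} : List A → List A → List A → Set where
  []    : Cover [] [] []
  both  : ∀ {x U S T} → Cover U S T → Cover (x ∷ U) (x ∷ S) (x ∷ T)
  left  : ∀ {x U S T} → Cover U S T → Cover (x ∷ U) (x ∷ S) T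
  right : ∀ {x U S T} → Cover U S T → Cover (x ∷ U) S (x ∷ T)

Cover⇒∈ : {x : A} {U S T : List A} → Cover U S T → x ∈ U → x ∈ S ⊎ x ∈ T
Cover⇒∈ (both c)  (here eq) = inj₁ (here eq)
Cover⇒∈ (left c)  (here eq) = inj₁ (here eq)
Cover⇒∈ (right c) (here eq) = inj₂ (here eq)
Cover⇒∈ (both c)  (there p) = Sum.map there there (Cover⇒∈ c p)
Cover⇒∈ (left c)  (there p) = Sum.map₁ there (Cover⇒∈ c p)
Cover⇒∈ (right c) (there p) = Sum.map₂ there (Cover⇒∈ c p)

-- By inclusion–exclusion the signed sum is the sum of f S * g T over the pairs (S , T) covering U.
coverSum-zero : (f g : List A → ℤ) (U : List A) → (∀ {S T} → Cover U S T → f S * g T ≡ 0ℤ) →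
                ε (length U) * Σ⊆ (λ W → ε (length W) * (Σ⊆ f W * Σ⊆ g W)) U ≡ 0ℤ
coverSum-zero f g [] fg≡0 = trans (ℤ.*-identityˡ _) (trans (ℤ.*-identityˡ _) (fg≡0 []))
coverSum-zero {A} f g (x ∷ U) fg≡0 = begin
  - e * (Σ⊆ (λ W → - ε (length W) * ((Σ⊆ f′ W + Σ⊆ f W) * (Σ⊆ g′ W + Σ⊆ g W))) U + M f g)
    ≡⟨ cong (λ z → - e * (z + M f g)) (trans
         (Σ⊆-cong U λ {W} _ → lemma₁ (ε (length W)) (Σ⊆ f′ W) (Σ⊆ f W) (Σ⊆ g′ W) (Σ⊆ g W))
         (trans (Σ⊆-* -1ℤ (λ W → m f′ g′ W + (m f′ g W + (m f g′ W + m f g W))) U)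
           (cong (-1ℤ *_) (trans (Σ⊆-+ (m f′ g′) _ U) (cong (_+_ (M f′ g′))
              (trans (Σ⊆-+ (m f′ g) _ U) (cong (_+_ (M f′ g)) (Σ⊆-+ (m f g′) (m f g) U)))))))) ⟩
  - e * (-1ℤ * (M f′ g′ + (M f′ g + (M f g′ + M f g))) + M f g)
    -- `M f g` collects the pairs in which neither member contains `x`; it enters once from the sets
    -- `W` with `x` and once from those without, with opposite signs.
    ≡⟨ lemma₂ e (M f′ g′) (M f′ g) (M f g′) (M f g) ⟩
  e * M f′ g′ + (e * M f′ g + e * M f g′)
    ≡⟨ cong₂ _+_ (coverSum-zero f′ g′ U (fg≡0 ∘ both))
                 (cong₂ _+_ (coverSum-zero f′ g U (fg≡0 ∘ left)) (coverSum-zero f g′ U (fg≡0 ∘ right))) ⟩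
  0ℤ ∎
  where
  f′ g′ : List A → ℤ
  f′ = f ∘ (x ∷_)
  g′ = g ∘ (x ∷_)
  e : ℤ
  e = ε (length U)
  m : (List A → ℤ) → (List A → ℤ) → List A → ℤ
  m p q W = ε (length W) * (Σ⊆ p W * Σ⊆ q W)
  M : (List A → ℤ) → (List A → ℤ) → ℤ
  M p q = Σ⊆ (m p q) U
  lemma₁ : ∀ s p′ p q′ q → - s * ((p′ + p) * (q′ + q)) ≡
           -1ℤ * (s * (p′ * q′) + (s * (p′ * q) + (s * (p * q′) + s * (p * q))))
  lemma₁ = solve-∀
  lemma₂ : ∀ s p q t w → - s * (-1ℤ * (p + (q + (t + w))) + w) ≡ s * p + (s * q + s * t)
  lemma₂ = solve-∀

-- Lists without repetitions and finite injections

lookup-injective : {xs : List A} → Unique xs → ∀ {i j} → lookup xs i ≡ lookup xs j → i ≡ j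
lookup-injective (x∉xs ∷ u) {zero}  {zero}  eq = refl
lookup-injective (x∉xs ∷ u) {zero}  {suc j} eq = contradiction eq (All.lookup x∉xs (∈-lookup j))
lookup-injective (x∉xs ∷ u) {suc i} {zero}  eq = contradiction (sym eq) (All.lookup x∉xs (∈-lookup i))
lookup-injective (x∉xs ∷ u) {suc i} {suc j} eq = cong suc (lookup-injective u eq)

unique-length-≤ : {xs ys : List A} → Unique xs → (∀ {x} → x ∈ xs → x ∈ ys) → length xs ≤ℕ length ys
unique-length-≤ {xs = xs} {ys} u xs⊆ys = injective⇒≤ {f = position} λ {i} {j} eq →
  lookup-injective u (trans (lookup-index (member i)) (trans (cong (lookup ys) eq) (sym (lookup-index (member j)))))
  where
  member : ∀ i → lookup xs i ∈ ys
  member i = xs⊆ys (∈-lookup i)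
  position : Fin (length xs) → Fin (length ys)
  position i = index (member i)

-- Injectivity is required on members only, because `orient` identifies `(u , v)` with `(v , u)`, of
-- which an edge list holds one.
map-unique : {xs : List A} (φ : A → B) → Unique xs →
             (∀ {x y} → x ∈ xs → y ∈ xs → φ x ≡ φ y → x ≡ y) → Unique (map φ xs)
map-unique φ []         inj = []
map-unique φ (x∉xs ∷ u) inj =
  All.tabulate (λ y′∈ φx≡y′ → let y , y∈xs , y′≡φy = ∈-map⁻ φ y′∈ in
    All.lookup x∉xs y∈xs (inj (here refl) (there y∈xs) (trans φx≡y′ y′≡φy)))
  ∷ map-unique φ u (λ x∈ y∈ → inj (there x∈) (there y∈))

-- A sublist of a list without repetitions is determined by its members. This yields equalities of
-- edge lists, not just permutations.
filter-sublist : {P : A → Set} (P? : Decidable P) {es xs : List A} → es ⊆ xs → Unique xs →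
                 (∀ {x} → x ∈ xs → P x → x ∈ es) → (∀ {x} → x ∈ es → P x) → filter P? xs ≡ es
filter-sublist P? [] u P⇒∈ ∈⇒P = refl
filter-sublist P? (x ∷ʳ s) (x∉xs ∷ u) P⇒∈ ∈⇒P = trans
  (List.filter-reject P? λ px → All.lookup x∉xs (Sublist.lookup s (P⇒∈ (here refl) px)) refl)
  (filter-sublist P? s u (P⇒∈ ∘ there) ∈⇒P)
filter-sublist P? {x ∷ es} (refl ∷ s) (x∉xs ∷ u) P⇒∈ ∈⇒P = trans
  (List.filter-accept P? (∈⇒P (here refl)))
  (cong (x ∷_) (filter-sublist P? s u (λ y∈ py → ∈-tail y∈ (P⇒∈ (there y∈) py)) (∈⇒P ∘ there)))
  where
  ∈-tail : ∀ {y} → y ∈ _ → y ∈ x ∷ es → y ∈ es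
  ∈-tail y∈xs (here refl) = contradiction refl (All.lookup x∉xs y∈xs)
  ∈-tail y∈xs (there y∈)  = y∈

transpose-matchˡ : (i j : Fin n) → Perm.transpose i j ⟨$⟩ʳ i ≡ j
transpose-matchˡ i j with i ≟ i
... | yes _   = refl
... | no  i≢i = contradiction refl i≢i

transpose-mismatch : {i j k : Fin n} → k ≢ i → k ≢ j → Perm.transpose i j ⟨$⟩ʳ k ≡ k
transpose-mismatch {i = i} {j} {k} k≢i k≢j with k ≟ i
... | yes k≡i = contradiction k≡i k≢i
... | no  _   with k ≟ j
...   | yes k≡j = contradiction k≡j k≢j
...   | no  _   = refl

-- Induction on `k`: a permutation right on all later points is followed by the transposition that
-- takes the image of `f zero` to `g zero`. It fixes the other images, which differ from both points
-- by injectivity of `f` and `g`.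
extendToPermutation : (f g : Fin k → Fin n) → (∀ {i j} → f i ≡ f j → i ≡ j) → (∀ {i j} → g i ≡ g j → i ≡ j) →
                      ∃ λ (π : Permutation n n) → ∀ i → π ⟨$⟩ʳ f i ≡ g i
extendToPermutation {zero}  f g f-inj g-inj = Perm.id , λ ()
extendToPermutation {suc k} f g f-inj g-inj
  with π , πf≡g ← extendToPermutation (f ∘ suc) (g ∘ suc) (Fin.suc-injective ∘ f-inj) (Fin.suc-injective ∘ g-inj)
  = π Perm.∘ₚ τ , λ where
      zero    → transpose-matchˡ (π ⟨$⟩ʳ f zero) (g zero)
      (suc i) → trans (transpose-mismatch (moved i) (fixed i)) (πf≡g i)
  where
  τ : Permutation _ _
  τ = Perm.transpose (π ⟨$⟩ʳ f zero) (g zero)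
  moved : ∀ i → π ⟨$⟩ʳ f (suc i) ≢ π ⟨$⟩ʳ f zero
  moved i eq with () ← f-inj (trans (sym (inverseˡ π)) (trans (cong (π ⟨$⟩ˡ_) eq) (inverseˡ π)))
  fixed : ∀ i → π ⟨$⟩ʳ f (suc i) ≢ g zero
  fixed i eq with () ← g-inj (trans (sym (πf≡g i)) eq)

-- Counting the sets of given size that contain a given set

module _ {P : Fin n → Set} (P? : Decidable P) where
  open DecMembership (_≟_ {n}) using (_∈?_)

  -- Only the elements of `P` listed in `xs` are required, so the condition shrinks together with
  -- `xs` in an induction.
  Containing : ℕ → List (Fin n) → List (Fin n) → Set
  Containing k xs V = length V ≡ k × All (λ x → P x → x ∈ V) xs

  containing? : ∀ k xs V → Dec (Containing k xs V)
  containing? k xs V = length V ℕ.≟ k ×-dec All.all? (λ x → P? x →-dec x ∈? V) xs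

  private
    cons : ∀ {k x xs V} → Containing k xs V → Containing (suc k) (x ∷ xs) (x ∷ V)
    cons (len , all) = cong suc len , (λ _ → here refl) ∷ All.map (λ f px → there (f px)) all

    uncons : ∀ {k x xs V} → All (x ≢_) xs → Containing (suc k) (x ∷ xs) (x ∷ V) → Containing k xs V
    uncons x∉xs (len , _ ∷ all) = ℕ.suc-injective len , All.zipWith (λ (x≢y , f) py → ∈-tail x≢y (f py)) (x∉xs , all)
      where
      ∈-tail : ∀ {x y V} → x ≢ y → y ∈ x ∷ V → y ∈ V
      ∈-tail x≢y (here y≡x) = contradiction (sym y≡x) x≢y
      ∈-tail x≢y (there y∈) = y∈

    Containing⇒≤ : ∀ {k xs V} → Unique xs → Containing k xs V → length (filter P? xs) ≤ℕ k
    Containing⇒≤ {xs = xs} u (refl , all) = unique-length-≤ (Unique.filter⁺ P? u)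
      (λ p → let y∈ , py = ∈-filter⁻ P? {xs = xs} p in All.lookup all y∈ py)

  -- The `p` required elements are forced and `s` more are chosen among the rest. An element of `P`
  -- at the head must be in `V`; any other head gives Pascal's rule. Writing the size as `p +ℕ s`
  -- spares a subtraction.
  count-containing : ∀ {xs} → Unique xs → ∀ {p} s → length (filter P? xs) ≡ p →
                     Σ⊆ (λ V → 𝟙 (containing? (p +ℕ s) xs V)) xs ≡ + ((length xs ∸ p) C s)
  count-containing {[]}     u          zero    refl = refl
  count-containing {[]}     u          (suc s) refl = refl
  count-containing {x ∷ xs} (x∉xs ∷ u) {p} s eq = cases (P? x) s
    where
    q : ℕ
    q = length (filter P? xs)

    with-x without-x : ℕ → ℤ
    with-x    k = Σ⊆ (λ V → 𝟙 (containing? k (x ∷ xs) (x ∷ V))) xs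
    without-x k = Σ⊆ (λ V → 𝟙 (containing? k (x ∷ xs) V)) xs

    with-x-suc : ∀ k → with-x (suc k) ≡ Σ⊆ (λ V → 𝟙 (containing? k xs V)) xs
    with-x-suc k = Σ⊆-cong xs λ {V} _ →
      𝟙-cong (containing? (suc k) (x ∷ xs) (x ∷ V)) (containing? k xs V) (uncons x∉xs) cons

    cases : Dec (P x) → ∀ s → with-x (p +ℕ s) + without-x (p +ℕ s) ≡ + ((length (x ∷ xs) ∸ p) C s)
    cases (yes px) s with refl ← trans (sym eq) (cong length (List.filter-accept P? {xs = xs} px)) = begin
      with-x (suc q +ℕ s) + without-x (suc q +ℕ s)
        ≡⟨ cong₂ _+_ (trans (with-x-suc (q +ℕ s)) (count-containing u s refl))
             (Σ⊆-zero xs λ {V} V⊆xs → 𝟙-no (containing? (suc q +ℕ s) (x ∷ xs) V)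
               λ (_ , all) → All.lookup x∉xs (Sublist.lookup V⊆xs (All.head all px)) refl) ⟩
      + ((length xs ∸ q) C s) + 0ℤ
        ≡⟨ ℤ.+-identityʳ _ ⟩
      + ((length xs ∸ q) C s) ∎
    cases (no ¬px) s with refl ← trans (sym eq) (cong length (List.filter-reject P? {xs = xs} ¬px)) = trans
      (cong (_+_ (with-x (q +ℕ s))) (trans (Σ⊆-cong xs λ {V} _ →
        𝟙-cong (containing? (q +ℕ s) (x ∷ xs) V) (containing? (q +ℕ s) xs V)
          (λ (len , all) → len , All.tail all)
          (λ (len , all) → len , (λ px → contradiction px ¬px) ∷ all))
        (count-containing u s refl)))
      (pascal s)
      where
      pascal : ∀ s → with-x (q +ℕ s) + + ((length xs ∸ q) C s) ≡ + ((suc (length xs) ∸ q) C s)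
      -- With no free place, choosing `x` as well would leave fewer than `q` places for the `q`
      -- required elements.
      pascal zero    = cong (_+ 1ℤ) (Σ⊆-zero xs λ {V} _ → 𝟙-no (containing? (q +ℕ 0) (x ∷ xs) (x ∷ V)) λ (len , all) →
        ℕ.<-irrefl refl (subst (_≤ℕ length V) (trans (sym (ℕ.+-identityʳ q)) (sym len))
          (Containing⇒≤ u (uncons x∉xs (refl , all)))))
      pascal (suc s) = begin
        with-x (q +ℕ suc s) + + ((length xs ∸ q) C suc s)
          ≡⟨ cong (λ k → with-x k + + ((length xs ∸ q) C suc s)) (ℕ.+-suc q s) ⟩
        with-x (suc (q +ℕ s)) + + ((length xs ∸ q) C suc s)
          ≡⟨ cong (_+ + ((length xs ∸ q) C suc s)) (trans (with-x-suc (q +ℕ s)) (count-containing u s refl)) ⟩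
        + ((length xs ∸ q) C s +ℕ (length xs ∸ q) C suc s)
          ≡⟨ cong +_ (nCk+nC[k+1]≡[n+1]C[k+1] (length xs ∸ q) s) ⟩
        + (suc (length xs ∸ q) C suc s)
          ≡⟨ cong (λ k → + (k C suc s)) (ℕ.+-∸-assoc 1 (List.length-filter P? xs)) ⟨
        + ((suc (length xs) ∸ q) C suc s) ∎

-- Edges and restrictions

Adj : Graph n → Fin n → Fin n → Set
Adj g u v = adj g u v ≡ true

Adj-sym : (g : Graph n) {u v : Fin n} → Adj g u v → Adj g v u
Adj-sym g {u} {v} uv = trans (adj-sym g v u) uv

Adj⇒≢ : (g : Graph n) {u v : Fin n} → Adj g u v → u ≢ v
Adj⇒≢ g {u} uv refl with () ← trans (sym uv) (adj-irrefl g u)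

Linked : List (Edge n) → Fin n → Fin n → Set
Linked es u v = (u , v) ∈ es ⊎ (v , u) ∈ es

Linked-mono : {es fs : List (Edge n)} {u v : Fin n} → (∀ {e} → e ∈ es → e ∈ fs) → Linked es u v → Linked fs u v
Linked-mono sub = Sum.map sub sub

Adj-↾⁺ : (h : Graph n) (es : List (Edge n)) {u v : Fin n} → Adj h u v → Linked es u v → Adj (h ↾ es) u v
Adj-↾⁺ {n} h es {u} {v} uv (inj₁ p) = cong₂ _∧_ uv (cong (_∨ does ((v , u) ∈? es)) (dec-true ((u , v) ∈? es) p))
  where open DecMembership (≡-dec (_≟_ {n}) (_≟_ {n})) using (_∈?_)
Adj-↾⁺ {n} h es {u} {v} uv (inj₂ p) = cong₂ _∧_ uv
  (trans (cong (does ((u , v) ∈? es) ∨_) (dec-true ((v , u) ∈? es) p)) (Bool.∨-zeroʳ _))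
  where open DecMembership (≡-dec (_≟_ {n}) (_≟_ {n})) using (_∈?_)

Adj-↾⁻ : (h : Graph n) (es : List (Edge n)) {u v : Fin n} → Adj (h ↾ es) u v → Adj h u v × Linked es u v
Adj-↾⁻ {n} h es {u} {v} eq with adj h u v | (u , v) ∈? es | (v , u) ∈? es
  where open DecMembership (≡-dec (_≟_ {n}) (_≟_ {n})) using (_∈?_)
... | true  | yes p | _     = refl , inj₁ p
... | true  | no _  | yes p = refl , inj₂ p
Adj-↾⁻ h es () | true  | no _ | no _
Adj-↾⁻ h es () | false | _ | _

↾-adj : (g : Graph a) (h : Graph b) (es : List (Edge a)) (fs : List (Edge b)) {u v : Fin a} {x y : Fin b} →
        adj g u v ≡ adj h x y → (Linked es u v → Linked fs x y) → (Linked fs x y → Linked es u v) →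
        adj (g ↾ es) u v ≡ adj (h ↾ fs) x y
↾-adj g h es fs eq to from = Bool.⇔→≡ {z = true} (mk⇔
  (λ p → let uv , l = Adj-↾⁻ g es p in Adj-↾⁺ h fs (trans (sym eq) uv) (to l))
  (λ p → let xy , l = Adj-↾⁻ h fs p in Adj-↾⁺ g es (trans eq xy) (from l)))

∈-edges⁺ : (g : Graph n) {u v : Fin n} → u < v → Adj g u v → (u , v) ∈ edges g
∈-edges⁺ g {u} {v} u<v uv = ∈-filter⁺ _ (∈-cartesianProduct⁺ (∈-allFin u) (∈-allFin v)) (u<v , uv)

∈-edges⁻ : (g : Graph n) {u v : Fin n} → (u , v) ∈ edges g → u < v × Adj g u v
∈-edges⁻ {n} g p = proj₂ (∈-filter⁻ (uncurry λ u v → u <? v ×-dec adj g u v Bool.≟ true)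
                                    {xs = cartesianProduct (allFin n) (allFin n)} p)

unique-pairs : ∀ n → Unique (cartesianProduct (allFin n) (allFin n))
unique-pairs n = Unique.cartesianProduct⁺ (Unique.allFin⁺ n) (Unique.allFin⁺ n)

unique-edges : (g : Graph n) → Unique (edges g)
unique-edges {n} g = Unique.filter⁺ _ (unique-pairs n)

-- Both lists follow the order of all pairs, so they are equal and not merely permuted. Hence sums
-- over the edges of `h ↾ es` are sums over `es`.
edges-↾ : (h : Graph n) {es : List (Edge n)} → es ⊆ edges h → edges (h ↾ es) ≡ es
edges-↾ {n} h {es} s = filter-sublist _ (⊆-trans s (filter-⊆ _ _)) (unique-pairs n)
  (λ where
    -- An adjacency witnessed by `(v , u)` in `es` would force `v < u`.
    _ (u<v , uv) → [ (λ p → p) , (λ vu → contradiction u<v (<-asym (proj₁ (∈-edges⁻ h (Sublist.lookup s vu))))) ]′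
                   (proj₂ (Adj-↾⁻ h es uv)))
  (λ p → let u<v , uv = ∈-edges⁻ h (Sublist.lookup s p) in u<v , Adj-↾⁺ h es uv (inj₁ p))

↾-↾ : (h : Graph n) {es fs : List (Edge n)} → es ⊆ fs → ∀ u v → adj ((h ↾ fs) ↾ es) u v ≡ adj (h ↾ es) u v
↾-↾ h {es} {fs} s u v = Bool.⇔→≡ {z = true} (mk⇔
  (λ p → let q , l = Adj-↾⁻ (h ↾ fs) es p in Adj-↾⁺ h es (proj₁ (Adj-↾⁻ h fs q)) l)
  (λ p → let q , l = Adj-↾⁻ h es p in Adj-↾⁺ (h ↾ fs) es (Adj-↾⁺ h fs q (Linked-mono (Sublist.lookup s) l)) l))

∈-nonIsolated⁺ : (g : Graph n) {v w : Fin n} → Adj g v w → v ∈ nonIsolated g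
∈-nonIsolated⁺ g {v} {w} vw = ∈-filter⁺ _ (∈-allFin v) (w , vw)

∈-nonIsolated⁻ : (g : Graph n) {v : Fin n} → v ∈ nonIsolated g → ∃ (Adj g v)
∈-nonIsolated⁻ {n} g p = proj₂ (∈-filter⁻ (λ v → any? λ w → adj g v w Bool.≟ true) {xs = allFin n} p)

unique-nonIsolated : (g : Graph n) → Unique (nonIsolated g)
unique-nonIsolated {n} g = Unique.filter⁺ _ (Unique.allFin⁺ n)

vertex : (g : Graph n) → Fin (cv g) → Fin n
vertex g = lookup (nonIsolated g)

vertex-injective : (g : Graph n) {i j : Fin (cv g)} → vertex g i ≡ vertex g j → i ≡ j
vertex-injective g = lookup-injective (unique-nonIsolated g)

vertex-surjective : (g : Graph n) {v w : Fin n} → Adj g v w → ∃ λ i → vertex g i ≡ v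
vertex-surjective g vw = index (∈-nonIsolated⁺ g vw) , sym (lookup-index (∈-nonIsolated⁺ g vw))

vertex-nonIsolated : (g : Graph n) (i : Fin (cv g)) → ∃ (Adj g (vertex g i))
vertex-nonIsolated g i = ∈-nonIsolated⁻ g (∈-lookup i)

cv≤n : (g : Graph n) → cv g ≤ℕ n
cv≤n g = injective⇒≤ (vertex-injective g)

-- Isomorphism up to isolated vertices

≅-sym : {g : Graph a} {h : Graph b} → g ≅ h → h ≅ g
≅-sym {h = h} iso = record
  { bijection     = Perm.flip π
  ; preserves-adj = λ u v → trans (sym (cong₂ (adj h) (inverseʳ π) (inverseʳ π))) (sym (preserves-adj _ _))
  }
  where open _≅_ iso renaming (bijection to π)

≅-refl : {g : Graph n} → g ≅ g
≅-refl = record { bijection = Perm.id ; preserves-adj = λ _ _ → refl }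

≅-trans : {g : Graph a} {h : Graph b} {f : Graph k} → g ≅ h → h ≅ f → g ≅ f
≅-trans p q = record
  { bijection     = _≅_.bijection p Perm.∘ₚ _≅_.bijection q
  ; preserves-adj = λ u v → trans (_≅_.preserves-adj p u v) (_≅_.preserves-adj q _ _)
  }

infix 4 _≈_ _≈?_ _↪_

_≈_ : Graph a → Graph b → Set
g ≈ h = removeIsolated g ≅ removeIsolated h

_≈?_ : (g : Graph a) (h : Graph b) → Dec (g ≈ h)
g ≈? h = removeIsolated g ≅? removeIsolated h

≈⇒cv≡ : (g : Graph a) (h : Graph b) → g ≈ h → cv g ≡ cv h
≈⇒cv≡ g h g≈h = Perm.↔⇒≡ (_≅_.bijection g≈h)

-- Up to relabelling, the map exhibits `h` as `g` with isolated vertices added. It covers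
-- isomorphisms as well as `removeIsolated g` inside `g`.
record _↪_ (g : Graph a) (h : Graph b) : Set where
  field
    ι           : Fin a → Fin b
    ι-injective : ∀ {u v} → ι u ≡ ι v → u ≡ v
    ι-adj       : ∀ u v → adj g u v ≡ adj h (ι u) (ι v)
    ι-covers    : ∀ {x y} → Adj h x y → ∃ λ u → ι u ≡ x

  ι-Adj : ∀ {u v} → Adj g u v → Adj h (ι u) (ι v)
  ι-Adj {u} {v} uv = trans (sym (ι-adj u v)) uv

  ι-Adj⁻ : ∀ {u v} → Adj h (ι u) (ι v) → Adj g u v
  ι-Adj⁻ {u} {v} uv = trans (ι-adj u v) uv

≅⇒↪ : {g : Graph a} {h : Graph b} → g ≅ h → g ↪ h
≅⇒↪ iso = record
  { ι           = π ⟨$⟩ʳ_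
  ; ι-injective = λ eq → trans (sym (inverseˡ π)) (trans (cong (π ⟨$⟩ˡ_) eq) (inverseˡ π))
  ; ι-adj       = preserves-adj
  ; ι-covers    = λ {x} _ → π ⟨$⟩ˡ x , inverseʳ π
  }
  where open _≅_ iso renaming (bijection to π)

removeIsolated-↪ : (g : Graph n) → removeIsolated g ↪ g
removeIsolated-↪ g = record
  { ι           = vertex g
  ; ι-injective = vertex-injective g
  ; ι-adj       = λ _ _ → refl
  ; ι-covers    = vertex-surjective g
  }

-- Both ends of any edge of `h` lie in the image, so the edge pulls back to `g`; hence `ι` restricts
-- to a bijection between the non-isolated vertices.
↪⇒≈ : (g : Graph a) (h : Graph b) → g ↪ h → g ≈ h
↪⇒≈ g h g↪h = record
  { bijection     = permutation (proj₁ ∘ to) (proj₁ ∘ from)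
      (λ j → vertex-injective h (trans (proj₂ (to _)) (proj₂ (from j))))
      (λ i → vertex-injective g (ι-injective (trans (proj₂ (from _)) (proj₂ (to i)))))
  ; preserves-adj = λ i j → trans (ι-adj (vertex g i) (vertex g j))
                                  (sym (cong₂ (adj h) (proj₂ (to i)) (proj₂ (to j))))
  }
  where
  open _↪_ g↪h
  to : ∀ i → ∃ λ j → vertex h j ≡ ι (vertex g i)
  to i = vertex-surjective h (ι-Adj (proj₂ (vertex-nonIsolated g i)))
  from : ∀ j → ∃ λ i → ι (vertex g i) ≡ vertex h j
  from j with y , jy ← vertex-nonIsolated h j
         with u , eq ← ι-covers jy
         with w , eq′ ← ι-covers (Adj-sym h jy)
    = let i , eq″ = vertex-surjective g {u} {w} (ι-Adj⁻ (trans (cong₂ (adj h) eq eq′) jy))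
      in i , trans (cong ι eq″) eq

≅⇒≈ : (g : Graph a) (h : Graph b) → g ≅ h → g ≈ h
≅⇒≈ g h iso = ↪⇒≈ g h (≅⇒↪ iso)

≗⇒≈ : (g h : Graph n) → (∀ u v → adj g u v ≡ adj h u v) → g ≈ h
≗⇒≈ g h eq = ↪⇒≈ g h record { ι = λ u → u ; ι-injective = λ p → p ; ι-adj = eq ; ι-covers = λ {x} _ → x , refl }

-- With equally many vertices, the bijection of the non-isolated ones extends to a permutation. It
-- reflects adjacency too, since a vertex sent to a non-isolated one is itself non-isolated. This
-- lets `distinct` apply to `_≈_`.
≈⇒≅ : (g h : Graph n) → g ≈ h → g ≅ h
≈⇒≅ g h g≈h = record
  { bijection     = π
  ; preserves-adj = λ u v → Bool.⇔→≡ {z = true} (mk⇔ to from)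
  }
  where
  open _≅_ g≈h renaming (bijection to σ)
  σ-injective : ∀ {i j} → σ ⟨$⟩ʳ i ≡ σ ⟨$⟩ʳ j → i ≡ j
  σ-injective eq = trans (sym (inverseˡ σ)) (trans (cong (σ ⟨$⟩ˡ_) eq) (inverseˡ σ))
  extension : ∃ λ (π : Permutation _ _) → ∀ i → π ⟨$⟩ʳ vertex g i ≡ vertex h (σ ⟨$⟩ʳ i)
  extension = extendToPermutation (vertex g) (vertex h ∘ (σ ⟨$⟩ʳ_))
                                  (vertex-injective g) (σ-injective ∘ vertex-injective h)
  π : Permutation _ _
  π = proj₁ extension
  to : ∀ {u v} → Adj g u v → Adj h (π ⟨$⟩ʳ u) (π ⟨$⟩ʳ v)
  to {u} {v} uv with i , refl ← vertex-surjective g uv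
                with j , refl ← vertex-surjective g (Adj-sym g uv)
    = trans (cong₂ (adj h) (proj₂ extension i) (proj₂ extension j)) (trans (sym (preserves-adj i j)) uv)
  vertex-of : ∀ {u y} → Adj h (π ⟨$⟩ʳ u) y → ∃ λ i → vertex g i ≡ u
  vertex-of {u} p with j , eq ← vertex-surjective h p = σ ⟨$⟩ˡ j , (begin
    vertex g (σ ⟨$⟩ˡ j)                    ≡⟨ inverseˡ π ⟨
    π ⟨$⟩ˡ (π ⟨$⟩ʳ vertex g (σ ⟨$⟩ˡ j))    ≡⟨ cong (π ⟨$⟩ˡ_) (trans (proj₂ extension _)
                                                                (trans (cong (vertex h) (inverseʳ σ)) eq)) ⟩
    π ⟨$⟩ˡ (π ⟨$⟩ʳ u)                      ≡⟨ inverseˡ π ⟩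
    u                                      ∎)
  from : ∀ {u v} → Adj h (π ⟨$⟩ʳ u) (π ⟨$⟩ʳ v) → Adj g u v
  from p with i , refl ← vertex-of p
         with j , refl ← vertex-of (Adj-sym h p)
    = trans (preserves-adj i j) (trans (sym (cong₂ (adj h) (proj₂ extension i) (proj₂ extension j))) p)

-- A permutation `π` moves the non-isolated vertices of `x` to the first `cv x` places; `g` is then
-- `x` on the vertices in the first `n` places.
∃↪ : n ≤ℕ a → (x : Graph a) → cv x ≤ℕ n → ∃ λ (g : Graph n) → g ↪ x
∃↪ {n} {a} n≤a x cv≤ = g , record
  { ι           = ι
  ; ι-injective = λ eq → inject≤-injective _ _ _ _ (trans (sym (inverseʳ π)) (trans (cong (π ⟨$⟩ʳ_) eq) (inverseʳ π)))
  ; ι-adj       = λ _ _ → refl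
  ; ι-covers    = covers
  }
  where
  extension : ∃ λ (π : Permutation a a) → ∀ i → π ⟨$⟩ʳ vertex x i ≡ inject≤ i (cv≤n x)
  extension = extendToPermutation (vertex x) (λ i → inject≤ i (cv≤n x))
                                  (vertex-injective x) (λ {i} {j} → inject≤-injective _ _ i j)
  π : Permutation a a
  π = proj₁ extension
  ι : Fin n → Fin a
  ι i = π ⟨$⟩ˡ inject≤ i n≤a
  g : Graph n
  g = record
    { adj        = λ u v → adj x (ι u) (ι v)
    ; adj-sym    = λ u v → adj-sym x (ι u) (ι v)
    ; adj-irrefl = λ v → adj-irrefl x (ι v)
    }
  covers : ∀ {u v} → Adj x u v → ∃ λ i → ι i ≡ u
  covers uv with j , refl ← vertex-surjective x uv = inject≤ j cv≤ , (begin
    π ⟨$⟩ˡ inject≤ (inject≤ j cv≤) n≤a  ≡⟨ cong (π ⟨$⟩ˡ_) (inject≤-idempotent j cv≤ n≤a (cv≤n x)) ⟩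
    π ⟨$⟩ˡ inject≤ j (cv≤n x)           ≡⟨ cong (π ⟨$⟩ˡ_) (proj₂ extension j) ⟨
    π ⟨$⟩ˡ (π ⟨$⟩ʳ vertex x j)          ≡⟨ inverseˡ π ⟩
    vertex x j                          ∎)

-- Invariants, and the transport of edges along embeddings

Invariant : (∀ {n} → Graph n → X) → Set _
Invariant Φ = ∀ {a b} (g : Graph a) (h : Graph b) → g ≈ h → Φ g ≡ Φ h

-- `g ≈ h` factors through `removeIsolated g` and `removeIsolated h`, and each of the three links is
-- an embedding.
invariant : (Φ : ∀ {n} → Graph n → X) → (∀ {a b} {g : Graph a} {h : Graph b} → g ↪ h → Φ g ≡ Φ h) → Invariant Φ
invariant Φ Φ-↪ g h g≈h =
  trans (sym (Φ-↪ (removeIsolated-↪ g))) (trans (Φ-↪ (≅⇒↪ g≈h)) (Φ-↪ (removeIsolated-↪ h)))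

-- `ι` need not respect the order of the vertices, while `edges` lists each edge with its smaller
-- end first.
orient : (Fin a → Fin b) → Edge a → Edge b
orient ι (u , v) = if does (ι u <? ι v) then (ι u , ι v) else (ι v , ι u)

orient-< : (ι : Fin a → Fin b) {u v : Fin a} → ι u < ι v → orient ι (u , v) ≡ (ι u , ι v)
orient-< ι {u} {v} lt = cong (λ d → if d then (ι u , ι v) else (ι v , ι u)) (dec-true (ι u <? ι v) lt)

orient-> : (ι : Fin a → Fin b) {u v : Fin a} → ι v < ι u → orient ι (u , v) ≡ (ι v , ι u)
orient-> ι {u} {v} gt = cong (λ d → if d then (ι u , ι v) else (ι v , ι u)) (dec-false (ι u <? ι v) (<-asym gt))

orient-cases : (ι : Fin a → Fin b) (u v : Fin a) → orient ι (u , v) ≡ (ι u , ι v) ⊎ orient ι (u , v) ≡ (ι v , ι u)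
orient-cases ι u v with does (ι u <? ι v)
... | true  = inj₁ refl
... | false = inj₂ refl

module _ {g : Graph a} {h : Graph b} (g↪h : g ↪ h) where
  open _↪_ g↪h

  private
    orient-injective : ∀ {p q u v} → orient ι (p , q) ≡ orient ι (u , v) → (p , q) ≡ (u , v) ⊎ (p , q) ≡ (v , u)
    orient-injective {p} {q} {u} {v} eq with orient-cases ι p q | orient-cases ι u v
    ... | inj₁ e | inj₁ f = inj₁ (cong₂ _,_ (ι-injective (cong proj₁ eq′)) (ι-injective (cong proj₂ eq′)))
      where eq′ = trans (sym e) (trans eq f)
    ... | inj₁ e | inj₂ f = inj₂ (cong₂ _,_ (ι-injective (cong proj₁ eq′)) (ι-injective (cong proj₂ eq′)))
      where eq′ = trans (sym e) (trans eq f)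
    ... | inj₂ e | inj₁ f = inj₂ (cong₂ _,_ (ι-injective (cong proj₂ eq′)) (ι-injective (cong proj₁ eq′)))
      where eq′ = trans (sym e) (trans eq f)
    ... | inj₂ e | inj₂ f = inj₁ (cong₂ _,_ (ι-injective (cong proj₂ eq′)) (ι-injective (cong proj₁ eq′)))
      where eq′ = trans (sym e) (trans eq f)

  edges-↪ : map (orient ι) (edges g) ↭ edges h
  edges-↪ = ∼bag⇒↭ (unique∧set⇒bag (map-unique (orient ι) (unique-edges g) inj) (unique-edges h) (mk⇔ to from))
    where
    inj : ∀ {e f} → e ∈ edges g → f ∈ edges g → orient ι e ≡ orient ι f → e ≡ f
    inj e∈ f∈ eq with orient-injective eq
    ... | inj₁ e≡f  = e≡f
    ... | inj₂ refl = contradiction (proj₁ (∈-edges⁻ g e∈)) (<-asym (proj₁ (∈-edges⁻ g f∈)))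
    to : ∀ {e} → e ∈ map (orient ι) (edges g) → e ∈ edges h
    to e∈ with (u , v) , uv∈ , refl ← ∈-map⁻ (orient ι) e∈
          with uv ← ι-Adj (proj₂ (∈-edges⁻ g uv∈))
          with <-cmp (ι u) (ι v)
    ... | tri< lt _ _ = subst (_∈ edges h) (sym (orient-< ι lt)) (∈-edges⁺ h lt uv)
    ... | tri≈ _ eq _ = contradiction eq (Adj⇒≢ h uv)
    ... | tri> _ _ gt = subst (_∈ edges h) (sym (orient-> ι gt)) (∈-edges⁺ h gt (Adj-sym h uv))
    from : ∀ {e} → e ∈ edges h → e ∈ map (orient ι) (edges g)
    from e∈ with lt , xy ← ∈-edges⁻ h e∈
            with u , refl ← ι-covers xy
            with v , refl ← ι-covers (Adj-sym h xy)
            with <-cmp u v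
    ... | tri< u<v _ _  = subst (_∈ _) (orient-< ι lt) (∈-map⁺ (orient ι) (∈-edges⁺ g u<v (ι-Adj⁻ xy)))
    ... | tri≈ _ refl _ = contradiction refl (Adj⇒≢ h xy)
    ... | tri> _ _ v<u  = subst (_∈ _) (orient-> ι lt) (∈-map⁺ (orient ι) (∈-edges⁺ g v<u (Adj-sym g (ι-Adj⁻ xy))))

  ↾-↪ : (S : List (Edge a)) → g ↾ S ↪ h ↾ map (orient ι) S
  ↾-↪ S = record
    { ι           = ι
    ; ι-injective = ι-injective
    ; ι-adj       = λ u v → ↾-adj g h S (map (orient ι) S) (ι-adj u v) to from
    ; ι-covers    = λ p → ι-covers (proj₁ (Adj-↾⁻ h (map (orient ι) S) p))
    }
    where
    to₁ : ∀ {u v} → (u , v) ∈ S → Linked (map (orient ι) S) (ι u) (ι v)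
    to₁ {u} {v} p = Sum.map at at (orient-cases ι u v)
      where
      at : ∀ {e} → orient ι (u , v) ≡ e → e ∈ map (orient ι) S
      at eq = subst (_∈ _) eq (∈-map⁺ (orient ι) p)
    to : ∀ {u v} → Linked S u v → Linked (map (orient ι) S) (ι u) (ι v)
    to = [ to₁ , Sum.swap ∘ to₁ ]′
    from₁ : ∀ {u v} → (ι u , ι v) ∈ map (orient ι) S → Linked S u v
    from₁ {u} {v} p with (s , t) , st∈ , eq ← ∈-map⁻ (orient ι) p with orient-cases ι s t
    ... | inj₁ e = inj₁ (subst (_∈ S) (sym (cong₂ _,_ (ι-injective (cong proj₁ eq′)) (ι-injective (cong proj₂ eq′)))) st∈)
      where eq′ = trans eq e
    ... | inj₂ e = inj₂ (subst (_∈ S) (sym (cong₂ _,_ (ι-injective (cong proj₂ eq′)) (ι-injective (cong proj₁ eq′)))) st∈)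
      where eq′ = trans eq e
    from : ∀ {u v} → Linked (map (orient ι) S) (ι u) (ι v) → Linked S u v
    from = [ from₁ , Sum.swap ∘ from₁ ]′

-- Counting copies

Σ↾ : (∀ {n} → Graph n → ℤ) → Graph n → ℤ
Σ↾ Φ h = Σ⊆ (λ S → Φ (h ↾ S)) (edges h)

-- `orient ι` matches the edge subsets of `g` with those of `h`, and matching restrictions agree up
-- to isolated vertices. The order of the edges does not matter, as adjacency in `h ↾ S` depends
-- only on the members of `S`.
Σ↾-invariant : (Φ : ∀ {n} → Graph n → ℤ) → Invariant Φ → Invariant (Σ↾ Φ)
Σ↾-invariant Φ Φ-inv = invariant (Σ↾ Φ) λ {_} {_} {g} {h} g↪h → let open _↪_ g↪h in begin
  Σ⊆ (λ S → Φ (g ↾ S)) (edges g)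
    ≡⟨ Σ⊆-cong (edges g) (λ {S} _ →
         Φ-inv (g ↾ S) (h ↾ map (orient ι) S) (↪⇒≈ (g ↾ S) (h ↾ map (orient ι) S) (↾-↪ g↪h S))) ⟩
  Σ⊆ (λ S → Φ (h ↾ map (orient ι) S)) (edges g)
    ≡⟨ Σ⊆-map (λ S → Φ (h ↾ S)) (orient ι) (edges g) ⟨
  Σ⊆ (λ S → Φ (h ↾ S)) (map (orient ι) (edges g))
    ≡⟨ Σ⊆-↭ (λ {S} {T} S↭T → Φ-inv (h ↾ S) (h ↾ T) (≗⇒≈ (h ↾ S) (h ↾ T) λ u v →
         ↾-adj h h S T refl (Linked-mono (∈-resp-↭ S↭T)) (Linked-mono (∈-resp-↭ (↭-sym S↭T))))) (edges-↪ g↪h) ⟩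
  Σ⊆ (λ S → Φ (h ↾ S)) (edges h) ∎

size-invariant : Invariant size
size-invariant = invariant size λ {_} {_} {g} {h} g↪h →
  trans (sym (List.length-map _ (edges g))) (↭-length (edges-↪ g↪h))

opaque
  -- Opaque, so that later goals do not unfold the exhaustive search behind `_≈?_`.
  isCopy : Graph a → ∀ {n} → Graph n → ℤ
  isCopy g x = 𝟙 (x ≈? g)

  isCopy-yes : (g : Graph a) (x : Graph n) → x ≈ g → isCopy g x ≡ 1ℤ
  isCopy-yes g x = 𝟙-yes (x ≈? g)

  isCopy-no : (g : Graph a) (x : Graph n) → ¬ x ≈ g → isCopy g x ≡ 0ℤ
  isCopy-no g x = 𝟙-no (x ≈? g)

  isCopy-cong : (g : Graph a) (x : Graph n) {p q : ℤ} → (x ≈ g → p ≡ q) → isCopy g x * p ≡ isCopy g x * q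
  isCopy-cong g x = 𝟙*-cong (x ≈? g)

  0≤isCopy : (g : Graph a) (x : Graph n) → 0ℤ ≤ isCopy g x
  0≤isCopy g x = 0≤𝟙 (x ≈? g)

  isCopy-invariant : (g : Graph a) → Invariant (isCopy g)
  isCopy-invariant g x y x≈y = 𝟙-cong (x ≈? g) (y ≈? g) (≅-trans (≅-sym x≈y)) (≅-trans x≈y)

  I≡Σ↾ : (g : Graph a) (h : Graph b) → + I g h ≡ Σ↾ (isCopy g) h
  I≡Σ↾ g h = length-filter-sublists (λ S → (h ↾ S) ≈? g) (edges h)

copies : Graph a → Graph b → ℤ
copies g h = Σ↾ (isCopy g) h

copies-invariant : (g : Graph a) → Invariant (copies g)
copies-invariant g = Σ↾-invariant (isCopy g) (isCopy-invariant g)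

size-↾ : (h : Graph n) {U : List (Edge n)} → U ⊆ edges h → size (h ↾ U) ≡ length U
size-↾ h U⊆ = cong length (edges-↾ h U⊆)

-- Restricting to `U` and then to `W` is restricting to `W`, so sums over subgraphs of `h ↾ U` can
-- be computed on sublists of `edges h`.
Σ↾-↾ : (Φ : ∀ {n} → Graph n → ℤ) → Invariant Φ → (h : Graph n) {U : List (Edge n)} → U ⊆ edges h →
       Σ↾ Φ (h ↾ U) ≡ Σ⊆ (λ W → Φ (h ↾ W)) U
Σ↾-↾ Φ Φ-inv h {U} U⊆ = trans (cong (Σ⊆ (λ W → Φ ((h ↾ U) ↾ W))) (edges-↾ h U⊆))
  (Σ⊆-cong U λ {W} W⊆ → Φ-inv ((h ↾ U) ↾ W) (h ↾ W) (≗⇒≈ ((h ↾ U) ↾ W) (h ↾ W) (↾-↾ h W⊆)))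

copies-↾ : (g : Graph a) (h : Graph n) {U : List (Edge n)} → U ⊆ edges h →
           copies g (h ↾ U) ≡ Σ⊆ (λ W → isCopy g (h ↾ W)) U
copies-↾ g h = Σ↾-↾ (isCopy g) (isCopy-invariant g) h

↾-edges : (h : Graph n) → (h ↾ edges h) ≈ h
↾-edges h = ≗⇒≈ (h ↾ edges h) h λ u v → Bool.⇔→≡ {z = true} (mk⇔
  (λ p → proj₁ (Adj-↾⁻ h (edges h) {u} {v} p))
  (λ p → Adj-↾⁺ h (edges h) {u} {v} p (linked p)))
  where
  linked : ∀ {u v} → Adj h u v → Linked (edges h) u v
  linked {u} {v} p with <-cmp u v
  ... | tri< u<v _ _ = inj₁ (∈-edges⁺ h u<v p)
  ... | tri≈ _ u≡v _ = contradiction u≡v (Adj⇒≢ h p)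
  ... | tri> _ _ v<u = inj₂ (∈-edges⁺ h v<u (Adj-sym h p))

cv≤length : (g : Graph n) (vs : List (Fin n)) → (∀ {u v} → Adj g u v → u ∈ vs) → cv g ≤ℕ length vs
cv≤length g vs covers = unique-length-≤ (unique-nonIsolated g) (λ p → covers (proj₂ (∈-nonIsolated⁻ g p)))

cv-↾ : (h : Graph n) (S : List (Edge n)) → cv (h ↾ S) ≤ℕ cv h
cv-↾ h S = cv≤length (h ↾ S) (nonIsolated h) (λ p → ∈-nonIsolated⁺ h (proj₁ (Adj-↾⁻ h S p)))

cv-Cover : (h : Graph n) {U S T : List (Edge n)} → Cover U S T → cv (h ↾ U) ≤ℕ cv (h ↾ S) +ℕ cv (h ↾ T)
cv-Cover h {U} {S} {T} cover = subst (cv (h ↾ U) ≤ℕ_) (List.length-++ (nonIsolated (h ↾ S)))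
  (cv≤length (h ↾ U) (nonIsolated (h ↾ S) ++ nonIsolated (h ↾ T)) incident)
  where
  incident : ∀ {u v} → Adj (h ↾ U) u v → u ∈ nonIsolated (h ↾ S) ++ nonIsolated (h ↾ T)
  incident p with uv , l ← Adj-↾⁻ h U p with l
  ... | inj₁ uv∈ = [ (λ q → ∈-++⁺ˡ (∈-nonIsolated⁺ (h ↾ S) (Adj-↾⁺ h S uv (inj₁ q))))
                   , (λ q → ∈-++⁺ʳ _ (∈-nonIsolated⁺ (h ↾ T) (Adj-↾⁺ h T uv (inj₁ q)))) ]′ (Cover⇒∈ cover uv∈)
  ... | inj₂ vu∈ = [ (λ q → ∈-++⁺ˡ (∈-nonIsolated⁺ (h ↾ S) (Adj-↾⁺ h S uv (inj₂ q))))
                   , (λ q → ∈-++⁺ʳ _ (∈-nonIsolated⁺ (h ↾ T) (Adj-↾⁺ h T uv (inj₂ q)))) ]′ (Cover⇒∈ cover vu∈)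

-- Subgraphs induced on sets of vertices

module _ (h : Graph n) where
  open DecMembership (_≟_ {n}) using (_∈?_)

  Inside : List (Fin n) → Edge n → Set
  Inside V (u , v) = u ∈ V × v ∈ V

  inside? : ∀ V → Decidable (Inside V)
  inside? V (u , v) = u ∈? V ×-dec v ∈? V

  -- Kept on all `n` vertices: those outside `V` become isolated, which `_≈_` ignores.
  induced : List (Fin n) → Graph n
  induced V = h ↾ filter (inside? V) (edges h)

  cv-induced : ∀ V → cv (induced V) ≤ℕ length V
  cv-induced V = cv≤length (induced V) V λ p →
    [ (λ e∈ → proj₁ (proj₂ (∈-filter⁻ (inside? V) {xs = edges h} e∈)))
    , (λ e∈ → proj₂ (proj₂ (∈-filter⁻ (inside? V) {xs = edges h} e∈))) ]′
    (proj₂ (Adj-↾⁻ h (filter (inside? V) (edges h)) p))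

  -- The ends of the edges in `W` are exactly the non-isolated vertices of `h ↾ W`. The vertex form
  -- of the condition is what `count-containing` counts.
  Inside⇔nonIsolated : ∀ {V W} → W ⊆ edges h →
    (All (Inside V) W → ∀ {u} → ∃ (Adj (h ↾ W) u) → u ∈ V) ×
    ((∀ {u} → ∃ (Adj (h ↾ W) u) → u ∈ V) → All (Inside V) W)
  Inside⇔nonIsolated {V} {W} W⊆ =
    (λ inside (v , uv) →
      [ (λ p → proj₁ (All.lookup inside p)) , (λ p → proj₂ (All.lookup inside p)) ]′ (proj₂ (Adj-↾⁻ h W uv))) ,
    (λ covers → All.tabulate λ {(u , v)} p → let uv = Adj-↾⁺ h W (proj₂ (∈-edges⁻ h (Sublist.lookup W⊆ p))) (inj₁ p)
      in covers (v , uv) , covers (u , Adj-sym (h ↾ W) uv))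

  -- Double counting of the pairs of a copy of g in h and an r-set of vertices containing it.
  Σ-induced : (g : Graph r) →
    Σ⊆ (λ V → 𝟙 (length V ℕ.≟ r) * copies g (induced V)) (allFin n) ≡ + ((n ∸ cv g) C (r ∸ cv g)) * copies g h
  Σ-induced {r} g = begin
    Σ⊆ (λ V → 𝟙 (length V ℕ.≟ r) * copies g (induced V)) (allFin n)
      ≡⟨ Σ⊆-cong (allFin n) (λ {V} _ → trans (cong (𝟙 (length V ℕ.≟ r) *_)
           (trans (copies-↾ g h (filter-⊆ (inside? V) (edges h))) (Σ⊆-filter (inside? V) copy (edges h))))
           (sym (Σ⊆-* (𝟙 (length V ℕ.≟ r)) (λ W → 𝟙 (All.all? (inside? V) W) * copy W) (edges h)))) ⟩
    Σ⊆ (λ V → Σ⊆ (λ W → 𝟙 (length V ℕ.≟ r) * (𝟙 (All.all? (inside? V) W) * copy W)) (edges h)) (allFin n)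
      ≡⟨ Σ⊆-swap (λ V W → 𝟙 (length V ℕ.≟ r) * (𝟙 (All.all? (inside? V) W) * copy W)) (allFin n) (edges h) ⟩
    Σ⊆ (λ W → Σ⊆ (λ V → 𝟙 (length V ℕ.≟ r) * (𝟙 (All.all? (inside? V) W) * copy W)) (allFin n)) (edges h)
      ≡⟨ Σ⊆-cong (edges h) (λ {W} W⊆ → begin
           Σ⊆ (λ V → 𝟙 (length V ℕ.≟ r) * (𝟙 (All.all? (inside? V) W) * copy W)) (allFin n)
             ≡⟨ Σ⊆-cong (allFin n) (λ {V} _ → rearrange W⊆ V) ⟩
           Σ⊆ (λ V → copy W * 𝟙 (containing? (nonIso? W) r (allFin n) V)) (allFin n)
             ≡⟨ Σ⊆-* (copy W) (λ V → 𝟙 (containing? (nonIso? W) r (allFin n) V)) (allFin n) ⟩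
           copy W * Σ⊆ (λ V → 𝟙 (containing? (nonIso? W) r (allFin n) V)) (allFin n)
             -- Only copies of `g` matter here, and they all have `cv g` non-isolated vertices, so
             -- each lies in equally many `r`-sets.
             ≡⟨ isCopy-cong g (h ↾ W) (λ W≈g → supersets W (≈⇒cv≡ (h ↾ W) g W≈g)) ⟩
           copy W * c
             ∎) ⟩
    Σ⊆ (λ W → copy W * c) (edges h)
      ≡⟨ Σ⊆-*ʳ copy c (edges h) ⟩
    copies g h * c
      ≡⟨ ℤ.*-comm (copies g h) c ⟩
    c * copies g h ∎
    where
    c : ℤ
    c = + ((n ∸ cv g) C (r ∸ cv g))

    copy : List (Edge n) → ℤ
    copy W = isCopy g (h ↾ W)

    nonIso? : ∀ W → Decidable (λ u → ∃ (Adj (h ↾ W) u))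
    nonIso? W u = any? λ v → adj (h ↾ W) u v Bool.≟ true

    rearrange : ∀ {W} → W ⊆ edges h → ∀ V →
      𝟙 (length V ℕ.≟ r) * (𝟙 (All.all? (inside? V) W) * copy W) ≡ copy W * 𝟙 (containing? (nonIso? W) r (allFin n) V)
    rearrange {W} W⊆ V = begin
      𝟙 (length V ℕ.≟ r) * (𝟙 (All.all? (inside? V) W) * copy W)
        ≡⟨ ℤ.*-assoc (𝟙 (length V ℕ.≟ r)) (𝟙 (All.all? (inside? V) W)) (copy W) ⟨
      𝟙 (length V ℕ.≟ r) * 𝟙 (All.all? (inside? V) W) * copy W
        ≡⟨ cong (_* copy W) (𝟙-× (length V ℕ.≟ r) (All.all? (inside? V) W)) ⟨
      𝟙 (length V ℕ.≟ r ×-dec All.all? (inside? V) W) * copy W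
        ≡⟨ cong (_* copy W) (𝟙-cong (length V ℕ.≟ r ×-dec All.all? (inside? V) W) (containing? (nonIso? W) r (allFin n) V)
             (λ (len , inside) → len , All.tabulate λ _ → proj₁ (Inside⇔nonIsolated W⊆) inside)
             (λ (len , all) → len , proj₂ (Inside⇔nonIsolated W⊆) λ {u} → All.lookup all (∈-allFin u))) ⟩
      𝟙 (containing? (nonIso? W) r (allFin n) V) * copy W
        ≡⟨ ℤ.*-comm (𝟙 (containing? (nonIso? W) r (allFin n) V)) (copy W) ⟩
      copy W * 𝟙 (containing? (nonIso? W) r (allFin n) V) ∎

    supersets : ∀ W → cv (h ↾ W) ≡ cv g → Σ⊆ (λ V → 𝟙 (containing? (nonIso? W) r (allFin n) V)) (allFin n) ≡ c
    supersets W eq = begin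
      Σ⊆ (λ V → 𝟙 (containing? (nonIso? W) r (allFin n) V)) (allFin n)
        -- `cv g` is at most `r`, which gives the size the form `p +ℕ s` of `count-containing`.
        ≡⟨ cong (λ k → Σ⊆ (λ V → 𝟙 (containing? (nonIso? W) k (allFin n) V)) (allFin n)) (ℕ.m+[n∸m]≡n (cv≤n g)) ⟨
      Σ⊆ (λ V → 𝟙 (containing? (nonIso? W) (cv g +ℕ (r ∸ cv g)) (allFin n) V)) (allFin n)
        ≡⟨ count-containing (nonIso? W) (Unique.allFin⁺ n) (r ∸ cv g) eq ⟩
      + ((length (allFin n) ∸ cv g) C (r ∸ cv g))
        ≡⟨ cong (λ k → + ((k ∸ cv g) C (r ∸ cv g))) (List.length-tabulate (λ (i : Fin n) → i)) ⟩
      c ∎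

-- Only the empty edge subset counts: a member of any other would give `g` a non-isolated vertex.
isCopy-edgeless : (g : Graph a) → Edgeless g → (h : Graph b) → Σ↾ (isCopy g) h ≡ 1ℤ
isCopy-edgeless g edgeless h = trans
  (Σ⊆-onlyEmpty (edges h) λ {e} {S} eS⊆ → isCopy-no g (h ↾ (e ∷ S)) λ h≈g →
    let u , v = e
        uv = Adj-↾⁺ h (e ∷ S) {u} {v} (proj₂ (∈-edges⁻ h (Sublist.lookup eS⊆ (here refl)))) (inj₁ (here refl))
    in noVertex g edgeless (_≅_.bijection h≈g ⟨$⟩ʳ proj₁ (vertex-surjective (h ↾ (e ∷ S)) uv)))
  (isCopy-yes g (h ↾ []) record
    { bijection     = permutation (⊥-elim ∘ none) (⊥-elim ∘ noVertex g edgeless)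
                                  (⊥-elim ∘ noVertex g edgeless) (⊥-elim ∘ none)
    ; preserves-adj = λ u → ⊥-elim (none u)
    })
  where
  noVertex : (g : Graph n) → Edgeless g → ¬ Fin (cv g)
  noVertex g edgeless i with v , iv ← vertex-nonIsolated g i with () ← trans (sym iv) (edgeless (vertex g i) v)
  none : ¬ Fin (cv (h ↾ []))
  none = noVertex (h ↾ []) λ u v → Bool.∧-zeroʳ (adj h u v)

-- Möbius inversion for copies and for pairs of copies

signedCopies : Graph a → Graph b → ℤ
signedCopies g x = ε (size x) * copies g x

signedCopies-invariant : (g : Graph a) → Invariant (signedCopies g)
signedCopies-invariant g x y x≈y = cong₂ (λ s c → ε s * c) (size-invariant x y x≈y) (copies-invariant g x y x≈y)

-- At the restriction to `S` the summand is the signed number of sublists of `S` that form copies of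
-- `g`, to which `möbius` applies.
Σ↾-signedCopies : (g : Graph a) (x : Graph b) → Σ↾ (signedCopies g) x ≡ ε (size x) * isCopy g x
Σ↾-signedCopies g x = begin
  Σ↾ (signedCopies g) x
    ≡⟨ Σ⊆-cong (edges x) (λ {S} S⊆ → cong₂ (λ s c → ε s * c) (size-↾ x S⊆) (copies-↾ g x S⊆)) ⟩
  total
    ≡⟨ ℤ.*-identityˡ total ⟨
  1ℤ * total
    ≡⟨ cong (_* total) (ε² (size x)) ⟨
  ε (size x) * ε (size x) * total
    ≡⟨ ℤ.*-assoc (ε (size x)) (ε (size x)) total ⟩
  ε (size x) * (ε (size x) * total)
    ≡⟨ cong (ε (size x) *_) (möbius (λ S → isCopy g (x ↾ S)) (edges x)) ⟩
  ε (size x) * isCopy g (x ↾ edges x)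
    ≡⟨ cong (ε (size x) *_) (isCopy-invariant g (x ↾ edges x) x (↾-edges x)) ⟩
  ε (size x) * isCopy g x ∎
  where
  total : ℤ
  total = Σ⊆ (λ S → ε (length S) * Σ⊆ (λ W → isCopy g (x ↾ W)) S) (edges x)

signedPairs : Graph a → Graph b → Graph n → ℤ
signedPairs f g x = ε (size x) * (copies f x * copies g x)

-- The number of pairs of a copy of f and a copy of g whose union is the edge set of x.
coveringPairs : Graph a → Graph b → Graph n → ℤ
coveringPairs f g x = ε (size x) * Σ↾ (signedPairs f g) x

module _ (f : Graph a) (g : Graph b) where

  signedPairs-invariant : Invariant (signedPairs f g)
  signedPairs-invariant x y x≈y = cong₂ (λ s c → ε s * c) (size-invariant x y x≈y)
    (cong₂ _*_ (copies-invariant f x y x≈y) (copies-invariant g x y x≈y))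

  coveringPairs-invariant : Invariant (coveringPairs f g)
  coveringPairs-invariant x y x≈y = cong₂ (λ s c → ε s * c) (size-invariant x y x≈y)
    (Σ↾-invariant (signedPairs f g) signedPairs-invariant x y x≈y)

  module _ (h : Graph n) where
    private
      F G : List (Edge n) → ℤ
      F S = isCopy f (h ↾ S)
      G T = isCopy g (h ↾ T)

    coveringPairs-↾ : ∀ {U} → U ⊆ edges h →
      coveringPairs f g (h ↾ U) ≡ ε (length U) * Σ⊆ (λ W → ε (length W) * (Σ⊆ F W * Σ⊆ G W)) U
    coveringPairs-↾ {U} U⊆ = cong₂ (λ s c → ε s * c) (size-↾ h U⊆)
      (trans (Σ↾-↾ (signedPairs f g) signedPairs-invariant h U⊆) (Σ⊆-cong U λ {W} W⊆U →
        let W⊆ = ⊆-trans W⊆U U⊆ in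
        cong₂ (λ s c → ε s * c) (size-↾ h W⊆) (cong₂ _*_ (copies-↾ f h W⊆) (copies-↾ g h W⊆))))

    -- Each pair of copies is counted at its union and nowhere else. Formally this is `möbius′` for
    -- the number of pairs of copies within `W`, taken at the whole edge set.
    Σ↾-coveringPairs : Σ↾ (coveringPairs f g) h ≡ copies f h * copies g h
    Σ↾-coveringPairs = trans (Σ⊆-cong (edges h) coveringPairs-↾) (möbius′ (λ W → Σ⊆ F W * Σ⊆ G W) (edges h))

    -- Copies of `f` and `g` with union `U` have at most `cv f +ℕ cv g` non-isolated vertices in
    -- total, so every term of the cover sum vanishes.
    coveringPairs-zero : ∀ {U} → U ⊆ edges h → cv f +ℕ cv g <ℕ cv (h ↾ U) → coveringPairs f g (h ↾ U) ≡ 0ℤ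
    coveringPairs-zero {U} U⊆ lt = trans (coveringPairs-↾ U⊆) (coverSum-zero F G U λ {S} {T} cover →
      trans (isCopy-cong f (h ↾ S) λ S≈f → isCopy-no g (h ↾ T) λ T≈g →
        ℕ.<-irrefl refl (ℕ.<-≤-trans lt (ℕ.≤-trans (cv-Cover h cover)
          (ℕ.≤-reflexive (cong₂ _+ℕ_ (≈⇒cv≡ (h ↾ S) f S≈f) (≈⇒cv≡ (h ↾ T) g T≈g))))))
      (ℤ.*-zeroʳ (F S)))

diag-·ᵛ : (d z : Vector k) (i : Fin k) → (diag d ·ᵛ z) i ≡ d i * z i
diag-·ᵛ d z i = trans
  (Σℤ-single i λ j j≢i → cong (λ b → (if b then d i else 0ℤ) * z j) (dec-false (i ≟ j) (j≢i ∘ sym)))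
  (cong (λ b → (if b then d i else 0ℤ) * z i) (dec-true (i ≟ i) refl))

-- Sums over representatives of the isomorphism classes

module _ {r m : ℕ} (classes : IsoClasses r m) where
  open IsoClasses classes

  private
    s : Fin (suc m) → ℤ
    s i = ε (size (rep i))

    e : Matrix (suc m)
    e i j = copies (rep j) (rep i)

  classify : r ≤ℕ n → (x : Graph n) → cv x ≤ℕ r → ∃ λ i → x ≈ rep i
  classify r≤n x cv≤ = let g , g↪x = ∃↪ r≤n x cv≤
                           i , g≅i = complete g
                       in i , ≅-trans (≅-sym (↪⇒≈ g x g↪x)) (≅⇒≈ g (rep i) g≅i)

  Σ-isCopy : (x : Graph n) {i : Fin (suc m)} → x ≈ rep i → (v : Fin (suc m) → ℤ) →
             Σℤ (λ l → isCopy (rep l) x * v l) ≡ v i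
  Σ-isCopy x {i} x≈i v = begin
    Σℤ (λ l → isCopy (rep l) x * v l)
      ≡⟨ Σℤ-single i (λ l l≢i → trans
           (cong (_* v l) (isCopy-no (rep l) x λ x≈l →
             l≢i (distinct l i (≈⇒≅ (rep l) (rep i) (≅-trans (≅-sym x≈l) x≈i)))))
           (ℤ.*-zeroˡ (v l))) ⟩
    isCopy (rep i) x * v i
      ≡⟨ cong (_* v i) (isCopy-yes (rep i) x x≈i) ⟩
    1ℤ * v i
      ≡⟨ ℤ.*-identityˡ (v i) ⟩
    v i ∎

  Σ-isCopy-none : (x : Graph n) → r <ℕ cv x → (v : Fin (suc m) → ℤ) → Σℤ (λ l → isCopy (rep l) x * v l) ≡ 0ℤ
  Σ-isCopy-none x r<cv v = Σℤ-zero λ l → trans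
    (cong (_* v l) (isCopy-no (rep l) x λ x≈l →
      ℕ.<-irrefl refl (ℕ.<-≤-trans r<cv (ℕ.≤-trans (ℕ.≤-reflexive (≈⇒cv≡ x (rep l) x≈l)) (cv≤n (rep l))))))
    (ℤ.*-zeroˡ (v l))

  -- After exchanging the sums, an edge subset with at most `r` non-isolated vertices meets exactly
  -- one class and contributes `Φ` there. A larger one meets none, and the last hypothesis makes its
  -- term on the right 0 as well.
  Σ-copies : (Φ : ∀ {n} → Graph n → ℤ) → Invariant Φ → r ≤ℕ n → (x : Graph n) →
             (∀ {S} → S ⊆ edges x → r <ℕ cv (x ↾ S) → Φ (x ↾ S) ≡ 0ℤ) →
             Σℤ (λ l → copies (rep l) x * Φ (rep l)) ≡ Σ↾ Φ x
  Σ-copies Φ Φ-inv r≤n x vanish = begin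
    Σℤ (λ l → copies (rep l) x * Φ (rep l))
      ≡⟨ Σℤ-cong (λ l → Σ⊆-*ʳ (λ S → isCopy (rep l) (x ↾ S)) (Φ (rep l)) (edges x)) ⟨
    Σℤ (λ l → Σ⊆ (λ S → isCopy (rep l) (x ↾ S) * Φ (rep l)) (edges x))
      ≡⟨ Σ⊆-Σℤ (λ S l → isCopy (rep l) (x ↾ S) * Φ (rep l)) (edges x) ⟨
    Σ⊆ (λ S → Σℤ (λ l → isCopy (rep l) (x ↾ S) * Φ (rep l))) (edges x)
      ≡⟨ Σ⊆-cong (edges x) (λ {S} S⊆ → term S S⊆ (cv (x ↾ S) ℕ.≤? r)) ⟩
    Σ↾ Φ x ∎
    where
    term : ∀ S → S ⊆ edges x → Dec (cv (x ↾ S) ≤ℕ r) → Σℤ (λ l → isCopy (rep l) (x ↾ S) * Φ (rep l)) ≡ Φ (x ↾ S)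
    term S S⊆ (yes cv≤) = let i , x≈i = classify r≤n (x ↾ S) cv≤ in
      trans (Σ-isCopy (x ↾ S) x≈i (λ l → Φ (rep l))) (sym (Φ-inv (x ↾ S) (rep i) x≈i))
    term S S⊆ (no cv≰) = trans (Σ-isCopy-none (x ↾ S) (ℕ.≰⇒> cv≰) (λ l → Φ (rep l))) (sym (vanish S⊆ (ℕ.≰⇒> cv≰)))

  Σ-copies-small : (Φ : ∀ {n} → Graph n → ℤ) → Invariant Φ → r ≤ℕ n → (x : Graph n) → cv x ≤ℕ r →
                   Σℤ (λ l → copies (rep l) x * Φ (rep l)) ≡ Σ↾ Φ x
  Σ-copies-small Φ Φ-inv r≤n x cv≤ = Σ-copies Φ Φ-inv r≤n x λ {S} _ r<cv →
    contradiction (ℕ.<-≤-trans r<cv (ℕ.≤-trans (cv-↾ x S) cv≤)) (ℕ.<-irrefl refl)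

  -- For `x = rep j` this gives the products of the transposed `E-transform` with its inverse.
  -- Graphs on more vertices occur as the induced subgraphs of `h`.
  inversion : r ≤ℕ n → (x : Graph n) → cv x ≤ℕ r → ∀ i →
              Σℤ (λ l → copies (rep l) x * (s l * e l i)) ≡ ε (size x) * isCopy (rep i) x
  inversion r≤n x cv≤ i = trans
    (Σ-copies-small (signedCopies (rep i)) (signedCopies-invariant (rep i)) r≤n x cv≤)
    (Σ↾-signedCopies (rep i) x)

  -- The inverse of the `E-transform` has the same entries with signs attached; this is the
  -- transpose of that inverse.
  inverse : Matrix (suc m)
  inverse i j = s i * s j * + I (rep i) (rep j)

  private
    -- The two products with `inverse`, on the left and on the right, lead to the same sum and
    -- differ only in the outer sign, `s i` or `s j`. These agree on the diagonal, and off it the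
    -- indicator is 0.
    scaled-inversion : ∀ i j → s i * (s j * isCopy (rep i) (rep j)) ≡ 1ᴹ i j
                             × s j * (s j * isCopy (rep i) (rep j)) ≡ 1ᴹ i j
    scaled-inversion i j with i ≟ j
    ... | yes refl = diagonal , diagonal
      where
      diagonal : s i * (s i * isCopy (rep i) (rep i)) ≡ 1ℤ
      diagonal = begin
        s i * (s i * isCopy (rep i) (rep i)) ≡⟨ cong (λ c → s i * (s i * c)) (isCopy-yes (rep i) (rep i) ≅-refl) ⟩
        s i * (s i * 1ℤ)                     ≡⟨ cong (s i *_) (ℤ.*-identityʳ (s i)) ⟩
        s i * s i                            ≡⟨ ε² (size (rep i)) ⟩
        1ℤ                                   ∎
    ... | no i≢j = zero-at (s i) , zero-at (s j)
      where
      zero-at : ∀ t → t * (s j * isCopy (rep i) (rep j)) ≡ 0ℤ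
      zero-at t = begin
        t * (s j * isCopy (rep i) (rep j)) ≡⟨ cong (λ c → t * (s j * c)) (isCopy-no (rep i) (rep j) λ j≈i →
          i≢j (sym (distinct j i (≈⇒≅ (rep j) (rep i) j≈i)))) ⟩
        t * (s j * 0ℤ)                     ≡⟨ cong (t *_) (ℤ.*-zeroʳ (s j)) ⟩
        t * 0ℤ                             ≡⟨ ℤ.*-zeroʳ t ⟩
        0ℤ                                 ∎

  inverseˡ-Eᵀ : inverse · (E-transform rep) ᵀ ≈ᴹ 1ᴹ
  inverseˡ-Eᵀ i j = begin
    Σℤ (λ l → s i * s l * + I (rep i) (rep l) * + I (rep l) (rep j))
      ≡⟨ Σℤ-cong (λ l → trans (cong₂ (λ p q → s i * s l * p * q) (I≡Σ↾ (rep i) (rep l)) (I≡Σ↾ (rep l) (rep j)))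
           (lemma (s i) (s l) (e l i) (e j l))) ⟩
    Σℤ (λ l → s i * (e j l * (s l * e l i)))
      ≡⟨ Σℤ-* (s i) (λ l → e j l * (s l * e l i)) ⟩
    s i * Σℤ (λ l → e j l * (s l * e l i))
      ≡⟨ cong (s i *_) (inversion ℕ.≤-refl (rep j) (cv≤n (rep j)) i) ⟩
    s i * (s j * isCopy (rep i) (rep j))
      ≡⟨ proj₁ (scaled-inversion i j) ⟩
    1ᴹ i j ∎
    where
    lemma : ∀ p q x y → p * q * x * y ≡ p * (y * (q * x))
    lemma = solve-∀

  inverseʳ-Eᵀ : (E-transform rep) ᵀ · inverse ≈ᴹ 1ᴹ
  inverseʳ-Eᵀ i j = begin
    Σℤ (λ l → + I (rep i) (rep l) * (s l * s j * + I (rep l) (rep j)))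
      ≡⟨ Σℤ-cong (λ l → trans (cong₂ (λ p q → p * (s l * s j * q)) (I≡Σ↾ (rep i) (rep l)) (I≡Σ↾ (rep l) (rep j)))
           (lemma (s l) (s j) (e l i) (e j l))) ⟩
    Σℤ (λ l → s j * (e j l * (s l * e l i)))
      ≡⟨ Σℤ-* (s j) (λ l → e j l * (s l * e l i)) ⟩
    s j * Σℤ (λ l → e j l * (s l * e l i))
      ≡⟨ cong (s j *_) (inversion ℕ.≤-refl (rep j) (cv≤n (rep j)) i) ⟩
    s j * (s j * isCopy (rep i) (rep j))
      ≡⟨ proj₂ (scaled-inversion i j) ⟩
    1ᴹ i j ∎
    where
    lemma : ∀ p q x y → x * (p * q * y) ≡ q * (y * (p * x))
    lemma = solve-∀

  inverse-D-z : r ≤ℕ n → (h : Graph n) → ∀ i →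
    (inverse ·ᵛ D-matrix n rep ·ᵛ (λ l → + I (rep l) h)) i
    ≡ Σ⊆ (λ V → 𝟙 (length V ℕ.≟ r) * isCopy (rep i) (induced h V)) (allFin n)
  inverse-D-z {n} r≤n h i = begin
    Σℤ (λ l → s i * s l * + I (rep i) (rep l) * (D-matrix n rep ·ᵛ (λ l → + I (rep l) h)) l)
      ≡⟨ Σℤ-cong (λ l → cong₂ (λ p q → s i * s l * p * q) (I≡Σ↾ (rep i) (rep l)) (weight l)) ⟩
    Σℤ (λ l → s i * s l * e l i * Σ⊆ (λ V → χ V * copies (rep l) (induced h V)) (allFin n))
      ≡⟨ Σℤ-cong (λ l → Σ⊆-* (s i * s l * e l i) (λ V → χ V * copies (rep l) (induced h V)) (allFin n)) ⟨
    Σℤ (λ l → Σ⊆ (λ V → s i * s l * e l i * (χ V * copies (rep l) (induced h V))) (allFin n))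
      ≡⟨ Σ⊆-Σℤ (λ V l → s i * s l * e l i * (χ V * copies (rep l) (induced h V))) (allFin n) ⟨
    Σ⊆ (λ V → Σℤ (λ l → s i * s l * e l i * (χ V * copies (rep l) (induced h V)))) (allFin n)
      ≡⟨ Σ⊆-cong (allFin n) (λ {V} _ → term V) ⟩
    Σ⊆ (λ V → χ V * isCopy (rep i) (induced h V)) (allFin n) ∎
    where
    χ : List (Fin n) → ℤ
    χ V = 𝟙 (length V ℕ.≟ r)

    weight : ∀ l → (D-matrix n rep ·ᵛ (λ l → + I (rep l) h)) l ≡ Σ⊆ (λ V → χ V * copies (rep l) (induced h V)) (allFin n)
    weight l = begin
      (D-matrix n rep ·ᵛ (λ l → + I (rep l) h)) l
        ≡⟨ diag-·ᵛ (λ l → + ((n ∸ cv (rep l)) C (r ∸ cv (rep l)))) (λ l → + I (rep l) h) l ⟩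
      + ((n ∸ cv (rep l)) C (r ∸ cv (rep l))) * + I (rep l) h
        ≡⟨ cong (+ ((n ∸ cv (rep l)) C (r ∸ cv (rep l))) *_) (I≡Σ↾ (rep l) h) ⟩
      + ((n ∸ cv (rep l)) C (r ∸ cv (rep l))) * copies (rep l) h
        ≡⟨ Σ-induced h (rep l) ⟨
      Σ⊆ (λ V → χ V * copies (rep l) (induced h V)) (allFin n) ∎

    lemma : ∀ p q x c y → p * q * x * (c * y) ≡ c * p * (y * (q * x))
    lemma = solve-∀

    term : ∀ V → Σℤ (λ l → s i * s l * e l i * (χ V * copies (rep l) (induced h V))) ≡ χ V * isCopy (rep i) (induced h V)
    term V = begin
      Σℤ (λ l → s i * s l * e l i * (χ V * copies (rep l) x))
        ≡⟨ Σℤ-cong (λ l → lemma (s i) (s l) (e l i) (χ V) (copies (rep l) x)) ⟩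
      Σℤ (λ l → χ V * s i * (copies (rep l) x * (s l * e l i)))
        ≡⟨ Σℤ-* (χ V * s i) (λ l → copies (rep l) x * (s l * e l i)) ⟩
      χ V * s i * Σℤ (λ l → copies (rep l) x * (s l * e l i))
        ≡⟨ ℤ.*-assoc (χ V) (s i) _ ⟩
      χ V * (s i * Σℤ (λ l → copies (rep l) x * (s l * e l i)))
        -- `χ V` supplies `length V ≡ r`, so the induced subgraph has at most `r` non-isolated
        -- vertices and `inversion` applies.
        ≡⟨ 𝟙*-cong (length V ℕ.≟ r) small ⟩
      χ V * isCopy (rep i) x ∎
      where
      x : Graph n
      x = induced h V

      small : length V ≡ r → s i * Σℤ (λ l → copies (rep l) x * (s l * e l i)) ≡ isCopy (rep i) x
      small refl = begin
        s i * Σℤ (λ l → copies (rep l) x * (s l * e l i))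
          ≡⟨ cong (s i *_) (inversion r≤n x (cv-induced h V) i) ⟩
        s i * (ε (size x) * isCopy (rep i) x)
          ≡⟨ rotate (s i) (ε (size x)) (isCopy (rep i) x) ⟩
        isCopy (rep i) x * (s i * ε (size x))
          -- If `x ≈ rep i`, both have the same number of edges and the two signs multiply to 1.
          ≡⟨ isCopy-cong (rep i) x (λ x≈i →
               trans (cong (λ k → s i * ε k) (size-invariant x (rep i) x≈i)) (ε² (size (rep i)))) ⟩
        isCopy (rep i) x * 1ℤ
          ≡⟨ ℤ.*-identityʳ (isCopy (rep i) x) ⟩
        isCopy (rep i) x ∎
        where
        rotate : ∀ p q t → p * (q * t) ≡ t * (p * q)
        rotate = solve-∀

  -- The weights `e k l` collect the edge subsets of `rep k` by their class, so the sum over `l` is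
  -- a sum over subsets; the sign of `rep k` comes out in front.
  structureConst≡coveringPairs : ∀ i j k → structureConst rep i j k ≡ coveringPairs (rep i) (rep j) (rep k)
  structureConst≡coveringPairs i j k = begin
    Σℤ (λ l → sign (+ size (rep k) - + size (rep l)) * + I (rep l) (rep k) * + I (rep i) (rep l) * + I (rep j) (rep l))
      ≡⟨ Σℤ-cong (λ l → trans
           (cong₂ (λ p (q , u , v) → p * q * u * v) (sign-minus (size (rep k)) (size (rep l)))
             (cong₂ _,_ (I≡Σ↾ (rep l) (rep k)) (cong₂ _,_ (I≡Σ↾ (rep i) (rep l)) (I≡Σ↾ (rep j) (rep l)))))
           (lemma (s k) (s l) (e k l) (e l i) (e l j))) ⟩
    Σℤ (λ l → s k * (e k l * signedPairs (rep i) (rep j) (rep l)))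
      ≡⟨ Σℤ-* (s k) (λ l → e k l * signedPairs (rep i) (rep j) (rep l)) ⟩
    s k * Σℤ (λ l → e k l * signedPairs (rep i) (rep j) (rep l))
      ≡⟨ cong (s k *_) (Σ-copies-small (signedPairs (rep i) (rep j)) (signedPairs-invariant (rep i) (rep j))
           ℕ.≤-refl (rep k) (cv≤n (rep k))) ⟩
    coveringPairs (rep i) (rep j) (rep k) ∎
    where
    lemma : ∀ p q x y z → p * q * x * y * z ≡ p * (x * (q * (y * z)))
    lemma = solve-∀

  product-formula : r ≤ℕ n → (h : Graph n) → ∀ i j → cv (rep i) +ℕ cv (rep j) ≤ℕ r →
    + I (rep i) h * + I (rep j) h ≡ Σℤ (λ k → structureConst rep i j k * + I (rep k) h)
  product-formula r≤n h i j cv≤ = begin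
    + I (rep i) h * + I (rep j) h
      ≡⟨ cong₂ _*_ (I≡Σ↾ (rep i) h) (I≡Σ↾ (rep j) h) ⟩
    copies (rep i) h * copies (rep j) h
      ≡⟨ Σ↾-coveringPairs (rep i) (rep j) h ⟨
    Σ↾ (coveringPairs (rep i) (rep j)) h
      ≡⟨ Σ-copies (coveringPairs (rep i) (rep j)) (coveringPairs-invariant (rep i) (rep j)) r≤n h
           -- A union with more than `r` non-isolated vertices belongs to no class; by the bound
           -- `cv≤` no pair of copies has such a union.
           (λ U⊆ r<cv → coveringPairs-zero (rep i) (rep j) h U⊆ (ℕ.≤-<-trans cv≤ r<cv)) ⟨
    Σℤ (λ k → copies (rep k) h * coveringPairs (rep i) (rep j) (rep k))
      ≡⟨ Σℤ-cong (λ k → trans (ℤ.*-comm (copies (rep k) h) (coveringPairs (rep i) (rep j) (rep k)))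
           (sym (cong₂ _*_ (structureConst≡coveringPairs i j k) (I≡Σ↾ (rep k) h)))) ⟩
    Σℤ (λ k → structureConst rep i j k * + I (rep k) h) ∎

theorem1 :
    ∀ (n r m : ℕ) → r ≤ℕ n →
    (classes : IsoClasses r m) (h : Graph n) →
    let
      g : Fin (suc m) → Graph r
      g = IsoClasses.rep classes
      z : Vector (suc m)
      z = λ i → + I (g i) h
      E : Matrix (suc m)
      E = E-transform g
      D : Matrix (suc m)
      D = D-matrix n g
      c : Fin (suc m) → Fin (suc m) → Fin (suc m) → ℤ
      c = structureConst g
    in
      z zero ≡ 1ℤ
      × (∀ i → 0ℤ ≤ z i)
      × Σ (Invertible _≈ᴹ_ 1ᴹ _·_ (E ᵀ)) (λ Eᵀ⁻¹ → ∀ i → 0ℤ ≤ (proj₁ Eᵀ⁻¹ ·ᵛ D ·ᵛ z) i)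
      × (∀ i j → cv (g i) +ℕ cv (g j) ≤ℕ r → z i * z j - Σℤ (λ k → c i j k * z k) ≡ 0ℤ)
theorem1 n r m r≤n classes h =
    trans (I≡Σ↾ (rep zero) h) (isCopy-edgeless (rep zero) rep-zero h)
  , (λ i → +≤+ z≤n)
  , ( (inverse classes , inverseˡ-Eᵀ classes , inverseʳ-Eᵀ classes)
    , λ i → subst (0ℤ ≤_) (sym (inverse-D-z classes r≤n h i))
        (0≤Σ⊆ (allFin n) λ V → nonneg (length V ℕ.≟ r) (0≤isCopy (rep i) (induced h V))))
  , (λ i j cv≤ → ℤ.i≡j⇒i-j≡0 (product-formula classes r≤n h i j cv≤))
  where
  open IsoClasses classes
  nonneg : (p? : Dec P) {x : ℤ} → 0ℤ ≤ x → 0ℤ ≤ 𝟙 p? * x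
  nonneg (yes _) {x} 0≤x = subst (0ℤ ≤_) (sym (ℤ.*-identityˡ x)) 0≤x
  nonneg (no _)  {x} 0≤x = subst (0ℤ ≤_) (sym (ℤ.*-zeroˡ x)) ℤ.≤-refl
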